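{- Suppose $\cdot\,;L\vdash P\triangleright\Delta$ is derivable in the liveness typing system (with empty process variable environment) and $P$ is lock-free. Then $P$ is live with respect to $\cdot,\Delta$: for every maximal transition sequence $(P_i,\lambda_i)_i$ of $P$ there is a live transition sequence $(\Delta_i,\delta_i)_i$ of $\Delta$ such that $((P_i,\Delta_i),(\lambda_i,\delta_i))_i$ is a typed transition sequence of $\cdot\vdash_{\mathsf{std}}P\triangleright\Delta$.
   Context: **Processes.** Channel names $c$; polarised channel names $c^+,c^-$, ranged over by $k,h$, with $\overline{c^+}=c^-$, $\overline{c^- }=c^+$. Data variables $x,i$; values $v$ (including naturals and $\mathsf{true},\mathsf{false}$); expressions $e$ (including variables and values); labels $l\in\mathcal L$ (countably infinite); process variables $X,Y$. Evaluation $e\Downarrow v$ is a total function; conditions evaluate to booleans and bounds $e$ in $\mathrm{rec}^e$ to naturals. Syntax: $$P::=k!\langle e\rangle.P\mid k?(x).P\mid k!l.P\mid k?\{l_i.P_i\}_{i\in I}\mid\mathbf 0\mid P|Q\mid\mathrm{rec}\,X.P\mid(\mathrm{rec}^e X(i).P;Q)\mid X[\tilde k]\mid\mathsf{if}\ e\ \mathsf{then}\ P\ \mathsf{else}\ Q$$ ($I$ finite non-empty; $\tilde k$ a finite collection of polarised names). $x$ binds in $k?(x).P$; $X$ in $\mathrm{rec}\,X.P$; $X,i$ bind in the body $P$ of $(\mathrm{rec}^e X(i).P;Q)$. Convention: the body $P$ of $(\mathrm{rec}^eX(i).P;Q)$ contains no $\mathbf 0$, no free process variable other than $X$, no sub-term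 $\mathrm{rec}\,Y.R$ or $(\mathrm{rec}^{e'}Y(j).R;S)$, and no sub-term $R|S$. $\mathsf{fn}(P)$ is the set of free polarised names, with $\mathsf{fn}(X[\tilde k])=\tilde k$. Substitutions are capture-avoiding; $X[\tilde k]\{Q/X\}=Q$. **Process transitions.** Labels $\lambda::=k!v\mid k?v\mid k\oplus l\mid k\& l\mid\tau\mid\tau{:}l$. $\mathsf{subj}$ of the first four is $k$; $\mathsf{subj}(\tau)=\mathsf{subj}(\tau{:}l)=\tau$; $\overline\tau=\tau$, not a channel. Rules: - Prefixes: $k!\langle e\rangle.P\xrightarrow{k!v}P$ if $e\Downarrow v$; $k?(x).P\xrightarrow{k?v}P\{v/x\}$; $k!l.P\xrightarrow{k\oplus l}P$ (each if $\overline k\notin\mathsf{fn}(P)$); $k?\{l_i.P_i\}_{i\in I}\xrightarrow{k\&l_i}P_i$ if $\overline k\notin\mathsf{fn}(P_i)$. - Par: if $P\xrightarrow{\lambda}Q$ and $\overline{\mathsf{subj}(\lambda)}\notin\mathsf{fn}(P')$ then $P|P'\xrightarrow{\lambda}Q|P'$; and symmetrically. - Com: if $P\xrightarrow{\overline k!v}P'$, $Q\xrightarrow{k?v}Q'$ then $P|Q\xrightarrow{\tau}P'|Q'$; if $P\xrightarrow{\overline k\oplus l}P'$, $Q\xrightarrow{k\&l}Q'$ then $P|Q\xrightarrow{\tau:l}P'|Q'$; and symmetrically. - Rec: if $P\{\mathrm{rec}\,X.P/X\}\xrightarrow{\lambda}Q$ then $\mathrm{rec}\,X.P\xrightarrow{\lambda}Q$.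 - Bounded rec: if $e\Downarrow0$ and $Q\xrightarrow{\lambda}R$, or $e\Downarrow n+1$ and $P\{n/i\}\{(\mathrm{rec}^nX(i).P;Q)/X\}\xrightarrow{\lambda}R$, then $(\mathrm{rec}^eX(i).P;Q)\xrightarrow{\lambda}R$. - Cond: $\mathsf{if}\ e\ \mathsf{then}\ P\ \mathsf{else}\ Q$ has the transitions of $P$ if $e\Downarrow\mathsf{true}$, of $Q$ if $e\Downarrow\mathsf{false}$. **Types.** $S,T::=\&\{l_i[L_i].T_i\}_{i\in I}\mid\oplus\{l_i[L_i].T_i\}_{i\in I}\mid\ !.T\mid\ ?.T\mid\mu t.T\mid t\mid\mathtt{end}$, $L_i\subseteq\mathcal L$, labels in each $\&,\oplus$ distinct; closed, contractive, identified with their infinite unfoldings. Transitions with labels $\rho::=!\mid?\mid\&l[L]\mid\oplus l[L]$: $!.T\xrightarrow{!}T$, $?.T\xrightarrow{?}T$, $\&\{l_i[L_i].T_i\}_{i\in I}\xrightarrow{\&l_i[L_i]}T_i$, $\oplus\{l_i[L_i].T_i\}_{i\in I}\xrightarrow{\oplus l_i[L_i]}T_i$. **Session environments.** $\Delta$ is a finite partial map from polarised channel names to types; $\Delta,\Delta'$ is union, defined for disjoint domains. $\Delta$ is completed if all its types are $\mathtt{end}$. Transitions, labels $\delta::=\tau\mid\tau{:}l,L\mid k{:}\rho$: if $T\xrightarrow{\rho}T'$ then $k{:}T\xrightarrow{k:\rho}k{:}T'$; if $\Delta\xrightarrow{\delta}\Delta'$ then $\Delta,\Delta''\xrightarrow{\delta}\Delta',\Delta''$;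 if $\Delta_1\xrightarrow{k:!}\Delta_1'$ and $\Delta_2\xrightarrow{\overline k:?}\Delta_2'$ then $\Delta_1,\Delta_2\xrightarrow{\tau}\Delta'_1,\Delta'_2$; if $\Delta_1\xrightarrow{k:\oplus l[L]}\Delta_1'$ and $\Delta_2\xrightarrow{\overline k:\&l[L']}\Delta_2'$ then $\Delta_1,\Delta_2\xrightarrow{\tau:l,L\cup L'}\Delta'_1,\Delta'_2$. $\mathsf{req}(\tau)=\mathsf{res}(\tau)=\mathsf{req}(k{:}!)=\mathsf{res}(k{:}!)=\mathsf{req}(k{:}?)=\mathsf{res}(k{:}?)=\emptyset$; for $\delta\in\{k{:}\&l[L],\,k{:}\oplus l[L],\,(\tau{:}l,L)\}$, $\mathsf{req}(\delta)=L$, $\mathsf{res}(\delta)=\{l\}$. A finite or infinite transition sequence with labels $\delta_1\delta_2\cdots$ is *live* iff for every $n$, $\mathsf{req}(\delta_n)\subseteq\bigcup_{m>n}\mathsf{res}(\delta_m)$. Correspondence $\delta\simeq\lambda$: $\tau\simeq\tau$; $(\tau{:}l,L)\simeq\tau{:}l$; $k{:}\&l[L]\simeq k\&l$; $k{:}\oplus l[L]\simeq k\oplus l$; $k{:}!\simeq k!v$; $k{:}?\simeq k?v$. **Liveness typing** $\Gamma;L\vdash P\triangleright\Delta$. $L\subseteq\mathcal L$; $\Gamma$ is a finite partial map from process variables to triples $(A,I,\Delta)$ (general recursion) or pairs $(L',\Delta)$ (bounded recursion), $A,I,L'\subseteq\mathcal L$. $\Gamma+l$ replaces each triple $(A,I,\Delta)$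 by $(A\cup\{l\},I,\Delta)$ and leaves pairs unchanged. Rules: - from $\Gamma;L\vdash P\triangleright\Delta,k{:}T$ infer $\Gamma;L\vdash k!\langle e\rangle.P\triangleright\Delta,k{:}!.T$ and $\Gamma;L\vdash k?(x).P\triangleright\Delta,k{:}?.T$; - if for all $i\in I$, $\Gamma+l_i;(L\setminus\{l_i\})\cup L_i\vdash P_i\triangleright\Delta,k{:}T_i$, then $\Gamma;L\vdash k?\{l_i.P_i\}_{i\in I}\triangleright\Delta,k{:}\&\{l_i[L_i].T_i\}_{i\in I}$; - if $j\in I$ and $\Gamma+l_j;(L\setminus\{l_j\})\cup L_j\vdash P\triangleright\Delta,k{:}T_j$, then $\Gamma;L\vdash k!l_j.P\triangleright\Delta,k{:}\oplus\{l_i[L_i].T_i\}_{i\in I}$; - if $\Gamma;L_1\vdash P_1\triangleright\Delta_1$ and $\Gamma;L_2\vdash P_2\triangleright\Delta_2$ then $\Gamma;L_1\cup L_2\vdash P_1|P_2\triangleright\Delta_1,\Delta_2$; - if $\Delta$ completed, $\Gamma;\emptyset\vdash\mathbf 0\triangleright\Delta$; - if $L\subseteq I\subseteq A$ and $\mathsf{dom}(\Delta)=\tilde k$, $\Gamma,X{:}(A,I,\Delta);L\vdash X[\tilde k]\triangleright\Delta$; - if $L\subseteq L'$ and $\mathsf{dom}(\Delta)=\tilde k$, $\Gamma,X{:}(L',\Delta);L\vdash X[\tilde k]\triangleright\Delta$; - if $\Gamma,X{:}(L',\Delta);L'\vdash P\triangleright\Delta$, $\Gamma;L'\vdash Q\triangleright\Delta$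 and $L\subseteq L'$, then $\Gamma;L\vdash(\mathrm{rec}^eX(i).P;Q)\triangleright\Delta$; - if $\Gamma,X{:}(\emptyset,I,\Delta);I\vdash P\triangleright\Delta$ and $L\subseteq I$, then $\Gamma;L\vdash\mathrm{rec}\,X.P\triangleright\Delta$; - if $\Gamma;L\vdash P\triangleright\Delta$ and $\Gamma;L\vdash Q\triangleright\Delta$ then $\Gamma;L\vdash\mathsf{if}\ e\ \mathsf{then}\ P\ \mathsf{else}\ Q\triangleright\Delta$. **Standard typing** $\Theta\vdash_{\mathsf{std}}P\triangleright\Delta$, where $\Theta$ maps process variables to session environments: the same rules with all $L$-components, the $+l$ operations and all label-set side conditions erased, and each triple $(A,I,\Delta)$ or pair $(L',\Delta)$ replaced by $\Delta$ (so e.g. $\Theta,X{:}\Delta\vdash_{\mathsf{std}}X[\tilde k]\triangleright\Delta$ if $\mathsf{dom}(\Delta)=\tilde k$). The *typed transition system* has states $\Theta\vdash_{\mathsf{std}}P\triangleright\Delta$ (derivable judgements) and a transition labelled $(\lambda,\delta)$ from $\Theta\vdash_{\mathsf{std}}P\triangleright\Delta$ to $\Theta\vdash_{\mathsf{std}}P'\triangleright\Delta'$ whenever $P\xrightarrow{\lambda}P'$, $\Delta\xrightarrow{\delta}\Delta'$ and $\delta\simeq\lambda$. **Occurrences, maximality, lock-freedom.** A transition sequence of $P$ is a finite $P=P_1\xrightarrow{\lambda_1}\cdots\xrightarrow{\lambda_{n-1}}P_n$ ($n\ge1$) or an infinite one; transitions in it are considered with their derivations. An *action* is a prefix (send, receive,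 select or branch). Top-level occurrences of actions in a process are identified by addresses $w\in\{\mathsf L,\mathsf R\}^*$, inductively: a prefixed process has one at the empty address; $P|Q$ has one at $\mathsf Lw$ for each address $w$ of $P$ and at $\mathsf Rw$ for each $w$ of $Q$; $\mathrm{rec}\,X.P$ has those of $P\{\mathrm{rec}\,X.P/X\}$; $(\mathrm{rec}^eX(i).P;Q)$ has those of $Q$ if $e\Downarrow0$ and those of $P\{n/i\}\{(\mathrm{rec}^nX(i).P;Q)/X\}$ if $e\Downarrow n+1$; a conditional has those of the chosen branch. A transition executes: the empty address (prefix rules); $\mathsf Lw$ (resp. $\mathsf Rw$) when the left (resp. right) component executes $w$ in Par; both $\mathsf Lw$ and $\mathsf Rw'$ in Com; the addresses executed by the premise in the recursion and conditional rules. A top-level occurrence not executed by a transition is preserved, at the same address. An occurrence is *enabled* in $P$ if some transition of $P$ executes it. An infinite transition sequence is *fair* iff every occurrence enabled in some $P_n$ is executed by $P_m\xrightarrow{\lambda_m}P_{m+1}$ for some $m\ge n$. A transition sequence is *maximal* iff it is finite with last process having no transitions, or infinite and fair. A maximal transition sequence $(P_i,\lambda_i)$ is *lock-free* iff every top-level occurrence in any $P_i$ is executed by $P_j\xrightarrow{\lambda_j}P_{j+1}$ for some $j\ge i$. A process is lock-free iff all its maximal transition sequences are. -}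

module Defs where

open import Data.Bool using (Bool; true; false)
open import Data.Empty using (⊥)
open import Data.Fin using (Fin; zero; suc; lift)
open import Data.List using (List; []; _∷_; _++_)
import Data.List.Membership.Propositional as List
open import Data.List.Membership.Propositional.Properties using (∈-++⁺ˡ; ∈-++⁺ʳ)
open import Data.List.Relation.Unary.Any using (here)
open import Data.Maybe using (Maybe; just; nothing; Is-just; _<∣>_)
open import Data.Maybe.Relation.Binary.Pointwise using (Pointwise)
import Data.Maybe.Relation.Unary.All as Maybe
import Data.Maybe.Relation.Unary.Any as Maybe
open import Data.Nat using (ℕ; zero; suc; _≤_; _<_)
open import Data.Product using (Σ; ∃-syntax; _×_; _,_; proj₁; proj₂)
open import Data.Product.Properties using (≡-dec)
open import Data.Sign using (Sign; opposite)
import Data.Sign.Properties as Sign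
open import Data.Unit using (⊤)
open import Data.Vec using (Vec; []; _∷_; lookup; map)
open import Function using (_∘_; _↔_; _⇔_; Injective)
open import Level using (0ℓ; _⊔_)
open import Relation.Binary.Construct.Closure.ReflexiveTransitive using (Star)
open import Relation.Binary.Definitions using (DecidableEquality)
open import Relation.Binary.PropositionalEquality using (_≡_; _≢_)
open import Relation.Nullary using (¬_; yes; no)
open import Relation.Unary using (Pred; _∈_; _⊆_; _≐_; _∪_; _∖_; ∅; Empty; ｛_｝)

-- The parts of the calculus that are left open: channel names, labels, and the
-- language of data.  Data variables are de Bruijn indices; `Expr m` are the
-- expressions over m of them, and `sub` is simultaneous substitution.
record Signature : Set₁ where
  field
    Chan       : Set
    _≟ᶜ_       : DecidableEquality Chan

    Label      : Set
    countable  : Label ↔ ℕ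

    Val        : Set
    nat        : ℕ → Val
    bool       : Bool → Val
    nat-inj    : Injective _≡_ _≡_ nat
    bool-inj   : Injective _≡_ _≡_ bool
    nat≢bool   : ∀ {n b} → nat n ≢ bool b

    Expr       : ℕ → Set
    var        : ∀ {m} → Fin m → Expr m
    val        : ∀ {m} → Val → Expr m
    sub        : ∀ {m m′} → (Fin m → Expr m′) → Expr m → Expr m′
    sub-var    : ∀ {m m′} (σ : Fin m → Expr m′) x → sub σ (var x) ≡ σ x
    sub-val    : ∀ {m m′} (σ : Fin m → Expr m′) v → sub σ (val v) ≡ val v

    -- e ⇓ v is eval e ≡ v.
    eval       : ∀ {m} → Expr m → Val
    eval-val   : ∀ {m} v → eval {m} (val v) ≡ v

-- Sequences with N transitions, where N = nothing stands for infinity, have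
-- states at the positions i ≤∞ N and transitions at the positions i <∞ N.
_<∞_ _≤∞_ : ℕ → Maybe ℕ → Set
i <∞ N = Maybe.All (i <_) N
i ≤∞ N = Maybe.All (i ≤_) N

-- `state` and `label` carry no information beyond the end of a finite run.
record Run {a b c} {S : Set a} {A : Set b} (Step : S → A → S → Set c) (s : S) :
           Set (a ⊔ b ⊔ c) where
  field
    len   : Maybe ℕ
    state : ℕ → S
    label : ℕ → A
    start : state 0 ≡ s
    step  : ∀ i → i <∞ len → Step (state i) (label i) (state (suc i))

module Calculus (S : Signature) where
  open Signature S

  private variable
    n n′ m m′ : ℕ

  PolChan : Set
  PolChan = Chan × Sign

  dual : PolChan → PolChan
  dual (c , p) = c , opposite p

  _≟_ : DecidableEquality PolChan
  _≟_ = ≡-dec _≟ᶜ_ Sign._≟_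

  LabelSet : Set₁
  LabelSet = Pred Label 0ℓ

  -- n bounds the free process variables and m the free data variables, both as
  -- de Bruijn indices.  In `brec e P Q`, which is (rec^e X(i).P;Q), both
  -- indices zero of P are bound, to X and i.
  data Proc (n m : ℕ) : Set where
    send   : PolChan → Expr m → Proc n m → Proc n m
    recv   : PolChan → Proc n (suc m) → Proc n m
    select : PolChan → Label → Proc n m → Proc n m
    branch : PolChan → (s : ℕ) → (Fin (suc s) → Label) → (Fin (suc s) → Proc n m) → Proc n m
    𝟎      : Proc n m
    _∥_    : Proc n m → Proc n m → Proc n m
    rec    : Proc (suc n) m → Proc n m
    brec   : Expr m → Proc (suc n) (suc m) → Proc n m → Proc n m
    call   : Fin n → List PolChan → Proc n m
    cond   : Expr m → Proc n m → Proc n m → Proc n m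

  -- The convention on the body P of a bounded recursion binding X: it has no
  -- inactive process, parallel composition or recursion, and no variable but X.
  Body : Fin n → Proc n m → Set
  Body X (send k e P)       = Body X P
  Body X (recv k P)         = Body X P
  Body X (select k l P)     = Body X P
  Body X (branch k s ls Ps) = ∀ i → Body X (Ps i)
  Body X 𝟎                  = ⊥
  Body X (P ∥ Q)            = ⊥
  Body X (rec P)            = ⊥
  Body X (brec e P Q)       = ⊥
  Body X (call Y ks)        = Y ≡ X
  Body X (cond e P Q)       = Body X P × Body X Q

  Conventional : Proc n m → Set
  Conventional (send k e P)       = Conventional P
  Conventional (recv k P)         = Conventional P
  Conventional (select k l P)     = Conventional P
  Conventional (branch k s ls Ps) = ∀ i → Conventional (Ps i)
  Conventional 𝟎                  = ⊤
  Conventional (P ∥ Q)            = Conventional P × Conventional Q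
  Conventional (rec P)            = Conventional P
  Conventional (brec e P Q)       = Body zero P × Conventional Q
  Conventional (call X ks)        = ⊤
  Conventional (cond e P Q)       = Conventional P × Conventional Q

  fn : Proc n m → Pred PolChan 0ℓ
  fn (send k e P)       = ｛ k ｝ ∪ fn P
  fn (recv k P)         = ｛ k ｝ ∪ fn P
  fn (select k l P)     = ｛ k ｝ ∪ fn P
  fn (branch k s ls Ps) = ｛ k ｝ ∪ λ h → ∃[ i ] h ∈ fn (Ps i)
  fn 𝟎                  = ∅
  fn (P ∥ Q)            = fn P ∪ fn Q
  fn (rec P)            = fn P
  fn (brec e P Q)       = fn P ∪ fn Q
  fn (call X ks)        = List._∈ ks
  fn (cond e P Q)       = fn P ∪ fn Q

  weakenE : Expr m → Expr (suc m)
  weakenE = sub (var ∘ suc)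

  liftE : (Fin m → Expr m′) → Fin (suc m) → Expr (suc m′)
  liftE σ zero    = var zero
  liftE σ (suc x) = weakenE (σ x)

  dsub : (Fin m → Expr m′) → Proc n m → Proc n m′
  dsub σ (send k e P)       = send k (sub σ e) (dsub σ P)
  dsub σ (recv k P)         = recv k (dsub (liftE σ) P)
  dsub σ (select k l P)     = select k l (dsub σ P)
  dsub σ (branch k s ls Ps) = branch k s ls λ i → dsub σ (Ps i)
  dsub σ 𝟎                  = 𝟎
  dsub σ (P ∥ Q)            = dsub σ P ∥ dsub σ Q
  dsub σ (rec P)            = rec (dsub σ P)
  dsub σ (brec e P Q)       = brec (sub σ e) (dsub (liftE σ) P) (dsub σ Q)
  dsub σ (call X ks)        = call X ks
  dsub σ (cond e P Q)       = cond (sub σ e) (dsub σ P) (dsub σ Q)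

  pren : (Fin n → Fin n′) → Proc n m → Proc n′ m
  pren ρ (send k e P)       = send k e (pren ρ P)
  pren ρ (recv k P)         = recv k (pren ρ P)
  pren ρ (select k l P)     = select k l (pren ρ P)
  pren ρ (branch k s ls Ps) = branch k s ls λ i → pren ρ (Ps i)
  pren ρ 𝟎                  = 𝟎
  pren ρ (P ∥ Q)            = pren ρ P ∥ pren ρ Q
  pren ρ (rec P)            = rec (pren (lift 1 ρ) P)
  pren ρ (brec e P Q)       = brec e (pren (lift 1 ρ) P) (pren ρ Q)
  pren ρ (call X ks)        = call (ρ X) ks
  pren ρ (cond e P Q)       = cond e (pren ρ P) (pren ρ Q)

  -- A process substitution also receives the names k̃ of the occurrence X[k̃]
  -- that it replaces, so that the variables it fixes can keep them.
  PSub : ℕ → ℕ → ℕ → Set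
  PSub n n′ m = Fin n → List PolChan → Proc n′ m

  weakenPSub : PSub n n′ m → PSub n n′ (suc m)
  weakenPSub τ X ks = dsub (var ∘ suc) (τ X ks)

  liftPSub : PSub n n′ m → PSub (suc n) (suc n′) m
  liftPSub τ zero    ks = call zero ks
  liftPSub τ (suc X) ks = pren suc (τ X ks)

  psub : PSub n n′ m → Proc n m → Proc n′ m
  psub τ (send k e P)       = send k e (psub τ P)
  psub τ (recv k P)         = recv k (psub (weakenPSub τ) P)
  psub τ (select k l P)     = select k l (psub τ P)
  psub τ (branch k s ls Ps) = branch k s ls λ i → psub τ (Ps i)
  psub τ 𝟎                  = 𝟎
  psub τ (P ∥ Q)            = psub τ P ∥ psub τ Q
  psub τ (rec P)            = rec (psub (liftPSub τ) P)
  psub τ (brec e P Q)       = brec e (psub (weakenPSub (liftPSub τ)) P) (psub τ Q)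
  psub τ (call X ks)        = τ X ks
  psub τ (cond e P Q)       = cond e (psub τ P) (psub τ Q)

  -- P [ v ]ᵈ is P{v/x} and P [ Q ]ᵖ is P{Q/X}, for the variables at index zero.
  _[_]ᵈ : Proc n (suc m) → Val → Proc n m
  P [ v ]ᵈ = dsub (λ { zero → val v ; (suc x) → var x }) P

  _[_]ᵖ : Proc (suc n) m → Proc n m → Proc n m
  P [ Q ]ᵖ = psub (λ { zero ks → Q ; (suc X) ks → call X ks }) P

  unfoldRec : Proc (suc n) m → Proc n m
  unfoldRec P = P [ rec P ]ᵖ

  unfoldBrec : ℕ → Proc (suc n) (suc m) → Proc n m → Proc n m
  unfoldBrec b P Q = (P [ nat b ]ᵈ) [ brec (val (nat b)) P Q ]ᵖ

  data Act : Set where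
    _!_ _⁇_ : PolChan → Val → Act
    _⊕_ _&_ : PolChan → Label → Act
    τ       : Act
    τ∶_     : Label → Act

  -- subj λ is nothing when the subject is τ, whose dual is not a channel.
  subj : Act → Maybe PolChan
  subj (k ! v) = just k
  subj (k ⁇ v) = just k
  subj (k ⊕ l) = just k
  subj (k & l) = just k
  subj τ       = nothing
  subj (τ∶ l)  = nothing

  _#_ : Act → Proc n m → Set
  a # P = Maybe.All (λ k → ¬ dual k ∈ fn P) (subj a)

  infix 4 _—[_]→_

  data _—[_]→_ : Proc n m → Act → Proc n m → Set where
    send   : ∀ {k e v} {P : Proc n m} → eval e ≡ v → ¬ dual k ∈ fn P →
             send k e P —[ k ! v ]→ P
    recv   : ∀ {k v} {P : Proc n (suc m)} → ¬ dual k ∈ fn P →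
             recv k P —[ k ⁇ v ]→ P [ v ]ᵈ
    select : ∀ {k l} {P : Proc n m} → ¬ dual k ∈ fn P →
             select k l P —[ k ⊕ l ]→ P
    branch : ∀ {k s ls} {Ps : Fin (suc s) → Proc n m} i → ¬ dual k ∈ fn (Ps i) →
             branch k s ls Ps —[ k & ls i ]→ Ps i

    parˡ   : ∀ {a} {P P′ Q : Proc n m} → P —[ a ]→ P′ → a # Q → P ∥ Q —[ a ]→ P′ ∥ Q
    parʳ   : ∀ {a} {P Q Q′ : Proc n m} → Q —[ a ]→ Q′ → a # P → P ∥ Q —[ a ]→ P ∥ Q′

    com!⁇  : ∀ {k v} {P P′ Q Q′ : Proc n m} →
             P —[ dual k ! v ]→ P′ → Q —[ k ⁇ v ]→ Q′ → P ∥ Q —[ τ ]→ P′ ∥ Q′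
    com⁇!  : ∀ {k v} {P P′ Q Q′ : Proc n m} →
             P —[ k ⁇ v ]→ P′ → Q —[ dual k ! v ]→ Q′ → P ∥ Q —[ τ ]→ P′ ∥ Q′
    com⊕&  : ∀ {k l} {P P′ Q Q′ : Proc n m} →
             P —[ dual k ⊕ l ]→ P′ → Q —[ k & l ]→ Q′ → P ∥ Q —[ τ∶ l ]→ P′ ∥ Q′
    com&⊕  : ∀ {k l} {P P′ Q Q′ : Proc n m} →
             P —[ k & l ]→ P′ → Q —[ dual k ⊕ l ]→ Q′ → P ∥ Q —[ τ∶ l ]→ P′ ∥ Q′

    rec    : ∀ {a} {P : Proc (suc n) m} {Q} →
             unfoldRec P —[ a ]→ Q → rec P —[ a ]→ Q
    brec-0 : ∀ {a e} {P : Proc (suc n) (suc m)} {Q R} →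
             eval e ≡ nat 0 → Q —[ a ]→ R → brec e P Q —[ a ]→ R
    brec-+ : ∀ {a e b} {P : Proc (suc n) (suc m)} {Q R} →
             eval e ≡ nat (suc b) → unfoldBrec b P Q —[ a ]→ R → brec e P Q —[ a ]→ R
    cond-t : ∀ {a e} {P Q R : Proc n m} →
             eval e ≡ bool true → P —[ a ]→ R → cond e P Q —[ a ]→ R
    cond-f : ∀ {a e} {P Q R : Proc n m} →
             eval e ≡ bool false → Q —[ a ]→ R → cond e P Q —[ a ]→ R

  -- P ⊳ Q: Q is what P exposes at top level, one constructor further in.
  data _⊳_ : Proc n m → Proc n m → Set where
    parˡ   : ∀ {P Q : Proc n m} → (P ∥ Q) ⊳ P
    parʳ   : ∀ {P Q : Proc n m} → (P ∥ Q) ⊳ Q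
    rec    : ∀ {P : Proc (suc n) m} → rec P ⊳ unfoldRec P
    brec-0 : ∀ {e} {P : Proc (suc n) (suc m)} {Q} → eval e ≡ nat 0 → brec e P Q ⊳ Q
    brec-+ : ∀ {e b} {P : Proc (suc n) (suc m)} {Q} →
             eval e ≡ nat (suc b) → brec e P Q ⊳ unfoldBrec b P Q
    cond-t : ∀ {e} {P Q : Proc n m} → eval e ≡ bool true → cond e P Q ⊳ P
    cond-f : ∀ {e} {P Q : Proc n m} → eval e ≡ bool false → cond e P Q ⊳ Q

  Evaluable : Proc n m → Set
  Evaluable (cond e P Q) = ∃[ b ] eval e ≡ bool b
  Evaluable (brec e P Q) = ∃[ b ] eval e ≡ nat b
  Evaluable _            = ⊤

  _⟶_ : Proc n m → Proc n m → Set
  P ⟶ Q = ∃[ a ] P —[ a ]→ Q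

  -- The evaluations that the execution of P calls for yield booleans (for
  -- conditions) and naturals (for bounds).  Nothing is asked of expressions that
  -- are never evaluated, in particular those still containing bound variables.
  WellSorted : Proc n m → Set
  WellSorted P = ∀ {P′ R} → Star _⟶_ P P′ → Star _⊳_ P′ R → Evaluable R

  record Branches {a} (A : Set a) : Set (a ⊔ Level.suc 0ℓ) where
    constructor branches
    field
      size     : ℕ
      label    : Fin (suc size) → Label
      distinct : Injective _≡_ _≡_ label
      req      : Fin (suc size) → LabelSet
      cont     : Fin (suc size) → A
  open Branches

  data Ty (n : ℕ) : Set₁ where
    bra sel : Branches (Ty n) → Ty n
    out inp : Ty n → Ty n
    μ       : Ty (suc n) → Ty n
    tvar    : Fin n → Ty n
    end     : Ty n

  tren : (Fin n → Fin n′) → Ty n → Ty n′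
  tren ρ (bra (branches s ls d Ls Ts)) = bra (branches s ls d Ls λ i → tren ρ (Ts i))
  tren ρ (sel (branches s ls d Ls Ts)) = sel (branches s ls d Ls λ i → tren ρ (Ts i))
  tren ρ (out T) = out (tren ρ T)
  tren ρ (inp T) = inp (tren ρ T)
  tren ρ (μ T)   = μ (tren (lift 1 ρ) T)
  tren ρ (tvar t) = tvar (ρ t)
  tren ρ end     = end

  liftTSub : (Fin n → Ty n′) → Fin (suc n) → Ty (suc n′)
  liftTSub σ zero    = tvar zero
  liftTSub σ (suc t) = tren suc (σ t)

  tsub : (Fin n → Ty n′) → Ty n → Ty n′
  tsub σ (bra (branches s ls d Ls Ts)) = bra (branches s ls d Ls λ i → tsub σ (Ts i))
  tsub σ (sel (branches s ls d Ls Ts)) = sel (branches s ls d Ls λ i → tsub σ (Ts i))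
  tsub σ (out T) = out (tsub σ T)
  tsub σ (inp T) = inp (tsub σ T)
  tsub σ (μ T)   = μ (tsub (liftTSub σ) T)
  tsub σ (tvar t) = σ t
  tsub σ end     = end

  unfoldμ : Ty (suc n) → Ty n
  unfoldμ T = tsub (λ { zero → μ T ; (suc t) → tvar t }) T

  Guarded : Fin n → Ty n → Set
  Guarded t (μ T)   = Guarded (suc t) T
  Guarded t (tvar s) = t ≢ s
  Guarded t _       = ⊤

  Contractive : Ty n → Set
  Contractive (bra (branches s ls d Ls Ts)) = ∀ i → Contractive (Ts i)
  Contractive (sel (branches s ls d Ls Ts)) = ∀ i → Contractive (Ts i)
  Contractive (out T) = Contractive T
  Contractive (inp T) = Contractive T
  Contractive (μ T)   = Guarded zero T × Contractive T
  Contractive (tvar t) = ⊤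
  Contractive end     = ⊤

  record SType : Set₁ where
    constructor _,_
    field
      raw         : Ty 0
      contractive : Contractive raw
  open SType

  end∙ : SType
  end∙ = end , _

  !∙ ⁇∙ : SType → SType
  !∙ (T , c) = out T , c
  ⁇∙ (T , c) = inp T , c

  &∙ ⊕∙ : Branches SType → SType
  &∙ (branches s ls d Ls Ts) =
    bra (branches s ls d Ls (raw ∘ Ts)) , contractive ∘ Ts
  ⊕∙ (branches s ls d Ls Ts) =
    sel (branches s ls d Ls (raw ∘ Ts)) , contractive ∘ Ts

  -- Families of branches are compared as sets, so their order is immaterial.
  MatchBranches : (Ty 0 → Ty 0 → Set₁) → Branches (Ty 0) → Branches (Ty 0) → Set₁
  MatchBranches R bs cs = (∀ i → ∃[ j ] MatchAt i j) × (∀ j → ∃[ i ] MatchAt i j)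
    where
    MatchAt : Fin (suc (size bs)) → Fin (suc (size cs)) → Set₁
    MatchAt i j = label bs i ≡ label cs j × req bs i ≐ req cs j × R (cont bs i) (cont cs j)

  -- After finitely many unfoldings of μ at the roots, the two roots agree and
  -- their immediate subtrees are related by R.
  data Match (R : Ty 0 → Ty 0 → Set₁) : Ty 0 → Ty 0 → Set₁ where
    bra : ∀ {bs cs} → MatchBranches R bs cs → Match R (bra bs) (bra cs)
    sel : ∀ {bs cs} → MatchBranches R bs cs → Match R (sel bs) (sel cs)
    out : ∀ {T U} → R T U → Match R (out T) (out U)
    inp : ∀ {T U} → R T U → Match R (inp T) (inp U)
    end : Match R end end
    μˡ  : ∀ {T U} → Match R (unfoldμ T) U → Match R (μ T) U
    μʳ  : ∀ {T U} → Match R T (unfoldμ U) → Match R T (μ U)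

  -- Equality of the infinite unfoldings, as the greatest bisimulation.  Types are
  -- identified along it: everything below is stated up to _≈_.
  _≈_ : SType → SType → Set₂
  T ≈ U = ∃[ R ] (∀ {T′ U′} → R T′ U′ → Match R T′ U′) × R (raw T) (raw U)

  data TLabel : Set₁ where
    !ᵗ ⁇ᵗ : TLabel
    &⟨_,_⟩ ⊕⟨_,_⟩ : Label → LabelSet → TLabel

  data _—⟨_⟩→_ (T : SType) : TLabel → SType → Set₂ where
    out : ∀ {T′} → T ≈ !∙ T′ → T —⟨ !ᵗ ⟩→ T′
    inp : ∀ {T′} → T ≈ ⁇∙ T′ → T —⟨ ⁇ᵗ ⟩→ T′
    bra : ∀ bs i → T ≈ &∙ bs → T —⟨ &⟨ label bs i , req bs i ⟩ ⟩→ cont bs i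
    sel : ∀ bs i → T ≈ ⊕∙ bs → T —⟨ ⊕⟨ label bs i , req bs i ⟩ ⟩→ cont bs i

  record Env : Set₁ where
    field
      at     : PolChan → Maybe SType
      finite : ∃[ ks ] ∀ k → Is-just (at k) → k List.∈ ks
  open Env

  dom : Env → Pred PolChan (Level.suc 0ℓ)
  dom Δ k = Is-just (at Δ k)

  at¹ : PolChan → SType → PolChan → Maybe SType
  at¹ k T h with h ≟ k
  ... | yes _ = just T
  ... | no  _ = nothing

  finite¹ : ∀ k T h → Is-just (at¹ k T h) → h List.∈ k ∷ []
  finite¹ k T h p with h ≟ k
  finite¹ k T h p  | yes h≡k = here h≡k
  finite¹ k T h () | no  _

  finite∪ : ∀ {x y : Maybe SType} {k} {ks hs : List PolChan} →
            (Is-just x → k List.∈ ks) → (Is-just y → k List.∈ hs) →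
            Is-just (x <∣> y) → k List.∈ ks ++ hs
  finite∪ {just _}            f g p = ∈-++⁺ˡ (f (Maybe.just _))
  finite∪ {nothing} {ks = ks} f g p = ∈-++⁺ʳ ks (g p)

  _∶_ : PolChan → SType → Env
  k ∶ T = record { at = at¹ k T ; finite = k ∷ [] , finite¹ k T }

  _∪ᴱ_ : Env → Env → Env
  Δ ∪ᴱ Δ′ = record
    { at     = λ k → at Δ k <∣> at Δ′ k
    ; finite = proj₁ (finite Δ) ++ proj₁ (finite Δ′) ,
               λ k → finite∪ {at Δ k} (proj₂ (finite Δ) k) (proj₂ (finite Δ′) k)
    }

  Disjoint : Env → Env → Set₁
  Disjoint Δ Δ′ = ∀ k → ¬ (k ∈ dom Δ × k ∈ dom Δ′)

  _≈ᴱ_ : Env → Env → Set₂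
  Δ ≈ᴱ Δ′ = ∀ k → Pointwise _≈_ (at Δ k) (at Δ′ k)

  -- Δ ≅ Δ₁ ⨟ Δ₂: the union Δ₁,Δ₂ is defined and equals Δ.
  _≅_⨟_ : Env → Env → Env → Set₂
  Δ ≅ Δ₁ ⨟ Δ₂ = Disjoint Δ₁ Δ₂ × Δ ≈ᴱ (Δ₁ ∪ᴱ Δ₂)

  Completed : Env → Set₂
  Completed Δ = ∀ k T → at Δ k ≡ just T → T ≈ end∙

  data ELabel : Set₁ where
    τ       : ELabel
    τ∶⟨_,_⟩ : Label → LabelSet → ELabel
    _⦂_     : PolChan → TLabel → ELabel

  infix 4 _—[_]→ᴱ_

  data _—[_]→ᴱ_ : Env → ELabel → Env → Set₂ where
    type   : ∀ {k T ρ T′} → T —⟨ ρ ⟩→ T′ → (k ∶ T) —[ k ⦂ ρ ]→ᴱ (k ∶ T′)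
    frame  : ∀ {Δ₁ Δ₁′ Δ₂ Δ Δ′ δ} →
             Δ₁ —[ δ ]→ᴱ Δ₁′ → Δ ≅ Δ₁ ⨟ Δ₂ → Δ′ ≅ Δ₁′ ⨟ Δ₂ → Δ —[ δ ]→ᴱ Δ′
    com!⁇  : ∀ {Δ₁ Δ₁′ Δ₂ Δ₂′ Δ Δ′ k} →
             Δ₁ —[ k ⦂ !ᵗ ]→ᴱ Δ₁′ → Δ₂ —[ dual k ⦂ ⁇ᵗ ]→ᴱ Δ₂′ →
             Δ ≅ Δ₁ ⨟ Δ₂ → Δ′ ≅ Δ₁′ ⨟ Δ₂′ → Δ —[ τ ]→ᴱ Δ′
    com⊕&  : ∀ {Δ₁ Δ₁′ Δ₂ Δ₂′ Δ Δ′ k l L L′} →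
             Δ₁ —[ k ⦂ ⊕⟨ l , L ⟩ ]→ᴱ Δ₁′ → Δ₂ —[ dual k ⦂ &⟨ l , L′ ⟩ ]→ᴱ Δ₂′ →
             Δ ≅ Δ₁ ⨟ Δ₂ → Δ′ ≅ Δ₁′ ⨟ Δ₂′ → Δ —[ τ∶⟨ l , L ∪ L′ ⟩ ]→ᴱ Δ′

  request response : ELabel → LabelSet
  request τ                = ∅
  request τ∶⟨ l , L ⟩      = L
  request (k ⦂ !ᵗ)          = ∅
  request (k ⦂ ⁇ᵗ)          = ∅
  request (k ⦂ &⟨ l , L ⟩) = L
  request (k ⦂ ⊕⟨ l , L ⟩) = L

  response τ                = ∅
  response τ∶⟨ l , L ⟩      = ｛ l ｝
  response (k ⦂ !ᵗ)          = ∅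
  response (k ⦂ ⁇ᵗ)          = ∅
  response (k ⦂ &⟨ l , L ⟩) = ｛ l ｝
  response (k ⦂ ⊕⟨ l , L ⟩) = ｛ l ｝

  EnvRun : Env → Set₂
  EnvRun = Run _—[_]→ᴱ_

  Live : ∀ {Δ} → EnvRun Δ → Set
  Live r = ∀ i → i <∞ len → request (Run.label r i) ⊆
           λ l → ∃[ j ] i < j × j <∞ len × l ∈ response (Run.label r j)
    where open Run r using (len)

  data _≃_ : ELabel → Act → Set₁ where
    τ   : τ ≃ τ
    τ∶  : ∀ {l L} → τ∶⟨ l , L ⟩ ≃ (τ∶ l)
    bra : ∀ {k l L} → (k ⦂ &⟨ l , L ⟩) ≃ (k & l)
    sel : ∀ {k l L} → (k ⦂ ⊕⟨ l , L ⟩) ≃ (k ⊕ l)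
    out : ∀ {k v} → (k ⦂ !ᵗ) ≃ (k ! v)
    inp : ∀ {k v} → (k ⦂ ⁇ᵗ) ≃ (k ⁇ v)

  data Entry : Set₁ where
    general : (A I : LabelSet) (Δ : Env) → Entry
    bounded : (L : LabelSet) (Δ : Env) → Entry

  Ctx : ℕ → Set₁
  Ctx = Vec Entry

  addE : Label → Entry → Entry
  addE l (general A I Δ) = general (A ∪ ｛ l ｝) I Δ
  addE l (bounded L Δ)   = bounded L Δ

  _⊞_ : Ctx n → Label → Ctx n
  Γ ⊞ l = map (addE l) Γ

  HasDom : Env → List PolChan → Set₁
  HasDom Δ ks = ∀ k → k ∈ dom Δ ⇔ k List.∈ ks

  infix 4 _⨾_⊢_▷_

  data _⨾_⊢_▷_ : Ctx n → LabelSet → Proc n m → Env → Set₂ where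
    send   : ∀ {Γ : Ctx n} {L Δ Δ₀ Δ₁ k T e} {P : Proc n m} →
             Δ ≅ Δ₀ ⨟ (k ∶ !∙ T) → Δ₁ ≅ Δ₀ ⨟ (k ∶ T) →
             Γ ⨾ L ⊢ P ▷ Δ₁ →
             Γ ⨾ L ⊢ send k e P ▷ Δ
    recv   : ∀ {Γ : Ctx n} {L Δ Δ₀ Δ₁ k T} {P : Proc n (suc m)} →
             Δ ≅ Δ₀ ⨟ (k ∶ ⁇∙ T) → Δ₁ ≅ Δ₀ ⨟ (k ∶ T) →
             Γ ⨾ L ⊢ P ▷ Δ₁ →
             Γ ⨾ L ⊢ recv k P ▷ Δ
    branch : ∀ {Γ : Ctx n} {L Δ Δ₀ k s ls Ls Ts} {d : Injective _≡_ _≡_ ls}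
               {Δs : Fin (suc s) → Env} {Ps : Fin (suc s) → Proc n m} →
             Δ ≅ Δ₀ ⨟ (k ∶ &∙ (branches s ls d Ls Ts)) →
             (∀ i → Δs i ≅ Δ₀ ⨟ (k ∶ Ts i)) →
             (∀ i → (Γ ⊞ ls i) ⨾ (L ∖ ｛ ls i ｝) ∪ Ls i ⊢ Ps i ▷ Δs i) →
             Γ ⨾ L ⊢ branch k s ls Ps ▷ Δ
    select : ∀ {Γ : Ctx n} {L Δ Δ₀ Δ₁ k bs} {P : Proc n m} j →
             Δ ≅ Δ₀ ⨟ (k ∶ ⊕∙ bs) → Δ₁ ≅ Δ₀ ⨟ (k ∶ cont bs j) →
             (Γ ⊞ label bs j) ⨾ (L ∖ ｛ label bs j ｝) ∪ req bs j ⊢ P ▷ Δ₁ →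
             Γ ⨾ L ⊢ select k (label bs j) P ▷ Δ
    par    : ∀ {Γ : Ctx n} {L L₁ L₂ Δ Δ₁ Δ₂} {P₁ P₂ : Proc n m} →
             L ≐ L₁ ∪ L₂ → Δ ≅ Δ₁ ⨟ Δ₂ →
             Γ ⨾ L₁ ⊢ P₁ ▷ Δ₁ → Γ ⨾ L₂ ⊢ P₂ ▷ Δ₂ →
             Γ ⨾ L ⊢ P₁ ∥ P₂ ▷ Δ
    nil    : ∀ {Γ : Ctx n} {L Δ} →
             Empty L → Completed Δ →
             Γ ⨾ L ⊢ 𝟎 {m = m} ▷ Δ
    call   : ∀ {Γ : Ctx n} {L A I Δ Δ′ X ks} →
             lookup Γ X ≡ general A I Δ′ → Δ ≈ᴱ Δ′ →
             L ⊆ I → I ⊆ A → HasDom Δ ks →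
             Γ ⨾ L ⊢ call {m = m} X ks ▷ Δ
    callᵇ  : ∀ {Γ : Ctx n} {L L′ Δ Δ′ X ks} →
             lookup Γ X ≡ bounded L′ Δ′ → Δ ≈ᴱ Δ′ →
             L ⊆ L′ → HasDom Δ ks →
             Γ ⨾ L ⊢ call {m = m} X ks ▷ Δ
    brec   : ∀ {Γ : Ctx n} {L L′ Δ e} {P : Proc (suc n) (suc m)} {Q} →
             (bounded L′ Δ ∷ Γ) ⨾ L′ ⊢ P ▷ Δ → Γ ⨾ L′ ⊢ Q ▷ Δ → L ⊆ L′ →
             Γ ⨾ L ⊢ brec e P Q ▷ Δ
    rec    : ∀ {Γ : Ctx n} {L I Δ} {P : Proc (suc n) m} →
             (general ∅ I Δ ∷ Γ) ⨾ I ⊢ P ▷ Δ → L ⊆ I →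
             Γ ⨾ L ⊢ rec P ▷ Δ
    cond   : ∀ {Γ : Ctx n} {L Δ e} {P Q : Proc n m} →
             Γ ⨾ L ⊢ P ▷ Δ → Γ ⨾ L ⊢ Q ▷ Δ →
             Γ ⨾ L ⊢ cond e P Q ▷ Δ

  infix 4 _⊢ₛ_▷_

  data _⊢ₛ_▷_ : Vec Env n → Proc n m → Env → Set₂ where
    send   : ∀ {Θ : Vec Env n} {Δ Δ₀ Δ₁ k T e} {P : Proc n m} →
             Δ ≅ Δ₀ ⨟ (k ∶ !∙ T) → Δ₁ ≅ Δ₀ ⨟ (k ∶ T) →
             Θ ⊢ₛ P ▷ Δ₁ →
             Θ ⊢ₛ send k e P ▷ Δ
    recv   : ∀ {Θ : Vec Env n} {Δ Δ₀ Δ₁ k T} {P : Proc n (suc m)} →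
             Δ ≅ Δ₀ ⨟ (k ∶ ⁇∙ T) → Δ₁ ≅ Δ₀ ⨟ (k ∶ T) →
             Θ ⊢ₛ P ▷ Δ₁ →
             Θ ⊢ₛ recv k P ▷ Δ
    branch : ∀ {Θ : Vec Env n} {Δ Δ₀ k s ls Ls Ts} {d : Injective _≡_ _≡_ ls}
               {Δs : Fin (suc s) → Env} {Ps : Fin (suc s) → Proc n m} →
             Δ ≅ Δ₀ ⨟ (k ∶ &∙ (branches s ls d Ls Ts)) →
             (∀ i → Δs i ≅ Δ₀ ⨟ (k ∶ Ts i)) →
             (∀ i → Θ ⊢ₛ Ps i ▷ Δs i) →
             Θ ⊢ₛ branch k s ls Ps ▷ Δ
    select : ∀ {Θ : Vec Env n} {Δ Δ₀ Δ₁ k bs} {P : Proc n m} j →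
             Δ ≅ Δ₀ ⨟ (k ∶ ⊕∙ bs) → Δ₁ ≅ Δ₀ ⨟ (k ∶ cont bs j) →
             Θ ⊢ₛ P ▷ Δ₁ →
             Θ ⊢ₛ select k (label bs j) P ▷ Δ
    par    : ∀ {Θ : Vec Env n} {Δ Δ₁ Δ₂} {P₁ P₂ : Proc n m} →
             Δ ≅ Δ₁ ⨟ Δ₂ → Θ ⊢ₛ P₁ ▷ Δ₁ → Θ ⊢ₛ P₂ ▷ Δ₂ →
             Θ ⊢ₛ P₁ ∥ P₂ ▷ Δ
    nil    : ∀ {Θ : Vec Env n} {Δ} → Completed Δ → Θ ⊢ₛ 𝟎 {m = m} ▷ Δ
    call   : ∀ {Θ : Vec Env n} {Δ X ks} →
             Δ ≈ᴱ lookup Θ X → HasDom Δ ks →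
             Θ ⊢ₛ call {m = m} X ks ▷ Δ
    brec   : ∀ {Θ : Vec Env n} {Δ e} {P : Proc (suc n) (suc m)} {Q} →
             (Δ ∷ Θ) ⊢ₛ P ▷ Δ → Θ ⊢ₛ Q ▷ Δ →
             Θ ⊢ₛ brec e P Q ▷ Δ
    rec    : ∀ {Θ : Vec Env n} {Δ} {P : Proc (suc n) m} →
             (Δ ∷ Θ) ⊢ₛ P ▷ Δ →
             Θ ⊢ₛ rec P ▷ Δ
    cond   : ∀ {Θ : Vec Env n} {Δ e} {P Q : Proc n m} →
             Θ ⊢ₛ P ▷ Δ → Θ ⊢ₛ Q ▷ Δ →
             Θ ⊢ₛ cond e P Q ▷ Δ

  record TypedStep (Θ : Vec Env n) (P : Proc n m) (Δ : Env) (a : Act) (δ : ELabel)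
                   (P′ : Proc n m) (Δ′ : Env) : Set₂ where
    field
      source   : Θ ⊢ₛ P ▷ Δ
      target   : Θ ⊢ₛ P′ ▷ Δ′
      process  : P —[ a ]→ P′
      env      : Δ —[ δ ]→ᴱ Δ′
      matching : δ ≃ a

  ProcRun : Proc n m → Set
  ProcRun = Run _—[_]→_

  data Dir : Set where
    left right : Dir

  Address : Set
  Address = List Dir

  data TopLevel : Proc n m → Address → Set where
    send   : ∀ {k e} {P : Proc n m} → TopLevel (send k e P) []
    recv   : ∀ {k} {P : Proc n (suc m)} → TopLevel (recv k P) []
    select : ∀ {k l} {P : Proc n m} → TopLevel (select k l P) []
    branch : ∀ {k s ls} {Ps : Fin (suc s) → Proc n m} → TopLevel (branch k s ls Ps) []
    parˡ   : ∀ {P Q : Proc n m} {w} → TopLevel P w → TopLevel (P ∥ Q) (left ∷ w)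
    parʳ   : ∀ {P Q : Proc n m} {w} → TopLevel Q w → TopLevel (P ∥ Q) (right ∷ w)
    rec    : ∀ {P : Proc (suc n) m} {w} → TopLevel (unfoldRec P) w → TopLevel (rec P) w
    brec-0 : ∀ {e} {P : Proc (suc n) (suc m)} {Q w} →
             eval e ≡ nat 0 → TopLevel Q w → TopLevel (brec e P Q) w
    brec-+ : ∀ {e b} {P : Proc (suc n) (suc m)} {Q w} →
             eval e ≡ nat (suc b) → TopLevel (unfoldBrec b P Q) w → TopLevel (brec e P Q) w
    cond-t : ∀ {e} {P Q : Proc n m} {w} →
             eval e ≡ bool true → TopLevel P w → TopLevel (cond e P Q) w
    cond-f : ∀ {e} {P Q : Proc n m} {w} →
             eval e ≡ bool false → TopLevel Q w → TopLevel (cond e P Q) w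

  _⊕ᵃ_ : Pred Address 0ℓ → Pred Address 0ℓ → Pred Address 0ℓ
  (A ⊕ᵃ B) []          = ⊥
  (A ⊕ᵃ B) (left ∷ w)  = w ∈ A
  (A ⊕ᵃ B) (right ∷ w) = w ∈ B

  Executes : ∀ {a} {P Q : Proc n m} → P —[ a ]→ Q → Pred Address 0ℓ
  Executes (send _ _)   = ｛ [] ｝
  Executes (recv _)     = ｛ [] ｝
  Executes (select _)   = ｛ [] ｝
  Executes (branch _ _) = ｛ [] ｝
  Executes (parˡ t _)   = Executes t ⊕ᵃ ∅
  Executes (parʳ t _)   = ∅ ⊕ᵃ Executes t
  Executes (com!⁇ t u)  = Executes t ⊕ᵃ Executes u
  Executes (com⁇! t u)  = Executes t ⊕ᵃ Executes u
  Executes (com⊕& t u)  = Executes t ⊕ᵃ Executes u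
  Executes (com&⊕ t u)  = Executes t ⊕ᵃ Executes u
  Executes (rec t)      = Executes t
  Executes (brec-0 _ t) = Executes t
  Executes (brec-+ _ t) = Executes t
  Executes (cond-t _ t) = Executes t
  Executes (cond-f _ t) = Executes t

  Enabled : Proc n m → Address → Set
  Enabled P w = ∃[ a ] ∃[ Q ] Σ (P —[ a ]→ Q) λ t → Executes t w

  module _ {P : Proc n m} (r : ProcRun P) where
    open Run r

    -- The occurrence at w in state i is executed at or after i.  An occurrence
    -- keeps its address until it is executed, so the first transition from i on to
    -- execute the address w is the one to execute that occurrence.
    Executed : ℕ → Address → Set
    Executed i w = ∃[ j ] i ≤ j × Σ (j <∞ len) λ p → Executes (step j p) w

    Fair : Set
    Fair = ∀ i → i ≤∞ len → ∀ w → TopLevel (state i) w → Enabled (state i) w → Executed i w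

    Maximal : Set
    Maximal = (∀ N → len ≡ just N → ¬ (∃[ Q ] state N ⟶ Q)) × (len ≡ nothing → Fair)

    LockFreeRun : Set
    LockFreeRun = ∀ i → i ≤∞ len → ∀ w → TopLevel (state i) w → Executed i w

  LockFree : Proc n m → Set
  LockFree P = (r : ProcRun P) → Maximal r → LockFreeRun r

  -- Pairing the two runs componentwise gives a run of the typed transition system
  -- from Θ ⊢ₛ P ▷ Δ.
  record IsTypedRun (Θ : Vec Env n) {P : Proc n m} {Δ} (r : ProcRun P) (q : EnvRun Δ) :
                    Set₂ where
    private
      module r = Run r
      module q = Run q
    field
      same-length : q.len ≡ r.len
      initial     : Θ ⊢ₛ P ▷ Δ
      typed-step  : ∀ i → i <∞ r.len →
                    TypedStep Θ (r.state i) (q.state i) (r.label i) (q.label i)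
                                (r.state (suc i)) (q.state (suc i))

  LiveWrt : Proc n m → Vec Env n → Env → Set₂
  LiveWrt P Θ Δ = (r : ProcRun P) → Maximal r →
                  Σ (EnvRun Δ) λ q → Live q × IsTypedRun Θ r q

-- Along a run, subject reduction builds the environment run and keeps a typing in which
-- the labels requested by each transition are pending.  It remains to see that a label l
-- pending in the typing of a process does occur later.  The typing rules force l to come
-- up on every path before a general recursion is called again, so general recursions are
-- unfolded at most once on the way to l, and bounded ones as often as their counter says;
-- this yields a well-founded rank for l, which is stable under substitution.  By
-- lock-freedom the component carrying the obligation is eventually executed, and each
-- such execution either answers l or lowers the rank.

module Submission where

open import Data.Bool using (true; false; if_then_else_)
open import Data.Empty using (⊥; ⊥-elim)
open import Data.Fin using (Fin; zero; suc; lift)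
open import Data.List using ([]; _∷_)
open import Data.Maybe using (Maybe; just; nothing; Is-just; _<∣>_)
import Data.Maybe.Relation.Binary.Pointwise as Pointwise
open Pointwise using (just; nothing)
import Data.Maybe.Relation.Unary.All as All
import Data.Maybe.Relation.Unary.Any as Maybe
open import Data.Nat using (ℕ; zero; suc; _+_; _∸_; _≤_; _<?_; s≤s)
open import Data.Nat.Properties using (+-suc; m∸n+n≡m; m≤n+m; n≤1+n; ≤-refl; ≤-trans; <⇒≤)
import Data.Nat.Properties as ℕ
open import Data.Product using (∃; ∃-syntax; _×_; _,_; proj₁; proj₂)
open import Data.Sign.Properties using (opposite-selfInverse)
open import Data.Sum using (_⊎_; inj₁; inj₂)
open import Data.Unit using (⊤; tt)
open import Data.Vec using (Vec; []; _∷_; lookup; map)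
open import Data.Vec.Properties using (lookup-map)
open import Function using (_∘_; id; mk⇔; Equivalence)
open import Function.Properties.Inverse using (↔⇒↣)
open import Induction.WellFounded using (Acc; acc; WellFounded)
open import Relation.Binary.Construct.Closure.ReflexiveTransitive using (Star; ε; _◅_; _◅◅_)
open import Relation.Binary.Definitions using (DecidableEquality)
open import Relation.Binary.PropositionalEquality using (_≡_; _≢_; refl; sym; trans; cong; subst)
open import Relation.Nullary using (¬_; Dec; yes; no)
open import Relation.Nullary.Decidable using (via-injection)
open import Relation.Unary using (_∈_; _∉_; _⊆_; _∪_; ∅; ｛_｝)
open import Relation.Unary.Properties using (≐-sym; ≐-trans)
open import Defs

module LivenessTyping (S : Signature) where

  open Signature S
  open Calculus S
  open Branches using (req; cont)
  open Env
  open SType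

  private variable
    n n′ m m′ : ℕ

  _≟ˡ_ : DecidableEquality Label
  _≟ˡ_ = via-injection (↔⇒↣ countable) ℕ._≟_

  -- Type and environment equality

  -- Reflexivity of _≈_ would need contractivity, but every environment in a
  -- derivation occurs on one side of an equality, so a partial equivalence is enough.
  module _ {R : Ty 0 → Ty 0 → Set₁} where

    Flip : Ty 0 → Ty 0 → Set₁
    Flip T U = R U T

    MatchBranches-sym : ∀ {bs cs} → MatchBranches R bs cs → MatchBranches Flip cs bs
    MatchBranches-sym {bs} {cs} (f , g) =
      (λ j → let i , eq , r , x = g j in i , sym eq , ≐-sym {x = req bs i} {y = req cs j} r , x) ,
      (λ i → let j , eq , r , x = f i in j , sym eq , ≐-sym {x = req bs i} {y = req cs j} r , x)

    Match-sym : ∀ {T U} → Match R T U → Match Flip U T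
    Match-sym (bra {bs} {cs} x) = bra (MatchBranches-sym {bs} {cs} x)
    Match-sym (sel {bs} {cs} x) = sel (MatchBranches-sym {bs} {cs} x)
    Match-sym (out x) = out x
    Match-sym (inp x) = inp x
    Match-sym end     = end
    Match-sym (μˡ p)  = μʳ (Match-sym p)
    Match-sym (μʳ p)  = μˡ (Match-sym p)

  module _ {R R′ : Ty 0 → Ty 0 → Set₁} where

    Compose : Ty 0 → Ty 0 → Set₁
    Compose T V = ∃[ U ] R T U × R′ U V

    MatchBranches-trans : ∀ {as bs cs} → MatchBranches R as bs → MatchBranches R′ bs cs →
                          MatchBranches Compose as cs
    MatchBranches-trans {as} {bs} {cs} (f , g) (f′ , g′) =
      (λ i → let j , eq , r , x = f i ; k , eq′ , r′ , x′ = f′ j in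
        k , trans eq eq′ , ≐-trans {i = req as i} {j = req bs j} {k = req cs k} r r′ , _ , x , x′) ,
      (λ k → let j , eq′ , r′ , x′ = g′ k ; i , eq , r , x = g j in
        i , trans eq eq′ , ≐-trans {i = req as i} {j = req bs j} {k = req cs k} r r′ , _ , x , x′)

    Match-trans : ∀ {T U V} → Match R T U → Match R′ U V → Match Compose T V
    Match-trans (μˡ p)  q       = μˡ (Match-trans p q)
    Match-trans p       (μʳ q)  = μʳ (Match-trans p q)
    -- Both derivations unfold the middle type here, so the two unfoldings cancel.
    Match-trans (μʳ p)  (μˡ q)  = Match-trans p q
    Match-trans (bra {as} {bs} x) (bra {cs = cs} y) = bra (MatchBranches-trans {as} {bs} {cs} x y)
    Match-trans (sel {as} {bs} x) (sel {cs = cs} y) = sel (MatchBranches-trans {as} {bs} {cs} x y)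
    Match-trans (out x) (out y) = out (_ , x , y)
    Match-trans (inp x) (inp y) = inp (_ , x , y)
    Match-trans end     end     = end

  ≈-sym : ∀ T U → T ≈ U → U ≈ T
  ≈-sym _ _ (R , match , TU) = Flip {R = R} , (λ x → Match-sym (match x)) , TU

  ≈-trans : ∀ T U V → T ≈ U → U ≈ V → T ≈ V
  ≈-trans _ _ _ (R , match , TU) (R′ , match′ , UV) =
    Compose {R} {R′} , (λ (_ , x , y) → Match-trans (match x) (match′ y)) , _ , TU , UV

  -- The relations on environments, on the underlying maps: f and g can be inferred
  -- from f ≋ g, whereas Δ ≈ᴱ Δ′ does not determine the finiteness witnesses.
  Assignment : Set₁
  Assignment = PolChan → Maybe SType

  infix 4 _≋_ _≋_⨟_

  _≋_ : Assignment → Assignment → Set₂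
  f ≋ g = ∀ k → Pointwise.Pointwise _≈_ (f k) (g k)

  support : Assignment → PolChan → Set₁
  support f k = Is-just (f k)

  _≋_⨟_ : Assignment → Assignment → Assignment → Set₂
  f ≋ g ⨟ h = (∀ k → ¬ (support g k × support h k)) × f ≋ λ k → g k <∣> h k

  private variable
    f g h g′ h′ : Assignment

  ≋-sym : f ≋ g → g ≋ f
  ≋-sym p k = Pointwise.sym (λ {T} {U} → ≈-sym T U) (p k)

  ≋-trans : f ≋ g → g ≋ h → f ≋ h
  ≋-trans p q k = Pointwise.trans (λ {T} {U} {V} → ≈-trans T U V) (p k) (q k)

  ≋-support : f ≋ g → support f ⊆ support g
  ≋-support {f} {g} p {k} d with f k | g k | p k
  ... | just _ | just _ | just _ = Maybe.just _

  ⨟-comm : f ≋ g ⨟ h → f ≋ h ⨟ g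
  ⨟-comm {f} {g} {h} (disjoint , p) = (λ k (a , b) → disjoint k (b , a)) , comm
    where
    comm : f ≋ λ k → h k <∣> g k
    comm k with g k | h k | p k | disjoint k
    ... | just _  | just _  | _ | d = ⊥-elim (d (Maybe.just _ , Maybe.just _))
    ... | just _  | nothing | q | _ = q
    ... | nothing | just _  | q | _ = q
    ... | nothing | nothing | q | _ = q

  ⨟-reflexive : f ≋ g ⨟ h → f ≋ f
  ⨟-reflexive (_ , p) = ≋-trans p (≋-sym p)

  -- Inherited from the whole: `<∣>` is biased to the left, so wherever `g` is defined the union
  -- takes its value. The right part follows by commutativity, where disjointness enters.
  ⨟-reflexiveˡ : f ≋ g ⨟ h → g ≋ g
  ⨟-reflexiveˡ {g = g} (_ , p) k with g k | ≋-trans (≋-sym p) p k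
  ... | just _  | q = q
  ... | nothing | _ = nothing

  ⨟-reflexiveʳ : f ≋ g ⨟ h → h ≋ h
  ⨟-reflexiveʳ p = ⨟-reflexiveˡ (⨟-comm p)

  ⨟-resp : f ≋ g → f ≋ g′ ⨟ h′ → g ≋ g′ ⨟ h′
  ⨟-resp q (disjoint , p) = disjoint , ≋-trans (≋-sym q) p

  <∣>-reflexive : f ≋ f → g ≋ g → (λ k → f k <∣> g k) ≋ λ k → f k <∣> g k
  <∣>-reflexive {f} p q k with f k | p k
  ... | just _  | just r  = just r
  ... | nothing | _ = q k

  -- Rebuilds the environment of a parallel composition after a step: the domains of the reducts do
  -- not grow, so their union is still defined.
  ⨟-∪ᴱ : f ≋ g ⨟ h → g′ ≋ g′ → h′ ≋ h′ → support g′ ⊆ support g → support h′ ⊆ support h →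
         (λ k → g′ k <∣> h′ k) ≋ g′ ⨟ h′
  ⨟-∪ᴱ (disjoint , _) p q dg dh = (λ k (a , b) → disjoint k (dg a , dh b)) , <∣>-reflexive p q

  <∣>-support : support g′ ⊆ support g → support h′ ⊆ support h →
                support (λ k → g′ k <∣> h′ k) ⊆ support λ k → g k <∣> h k
  <∣>-support {g′} {g} {h′} {h} dg dh {k} d with g′ k | g k | dg {k}
  ... | _       | just _  | _ = Maybe.just _
  ... | just _  | nothing | e with () ← e (Maybe.just _)
  ... | nothing | nothing | _ = dh d

  ⨟-support : f ≋ g ⨟ h → support g′ ⊆ support g → support h′ ⊆ support h →
              support (λ k → g′ k <∣> h′ k) ⊆ support f
  ⨟-support (_ , p) dg dh {k} d = ≋-support (≋-sym p) {k} (<∣>-support (λ {h} → dg {h}) (λ {h} → dh {h}) {k} d)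

  at¹-reflexive : ∀ k {T} → at¹ k T ≋ at¹ k T → T ≈ T
  at¹-reflexive k p with k ≟ k | p k
  ... | yes _   | just q = q
  ... | no  k≢k | _      = ⊥-elim (k≢k refl)

  at¹-support : ∀ k {T U} → support (at¹ k T) ⊆ support (at¹ k U)
  at¹-support k {x = h} d with h ≟ k
  ... | yes _ = Maybe.just _

  ⨟-support-at¹ : ∀ k {T U} → f ≋ h ⨟ at¹ k T → g ≋ h ⨟ at¹ k U → support g ⊆ support f
  ⨟-support-at¹ k p (_ , q) {h} d =
    ⨟-support p id (λ {h} → at¹-support k {x = h}) {h} (≋-support q {h} d)

  -- Structural properties of the typing

  ▷-reflexive : ∀ {Γ : Ctx n} {L Δ} {P : Proc n m} → Γ ⨾ L ⊢ P ▷ Δ → Δ ≈ᴱ Δ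
  ▷-reflexive (send p _ _)     = ⨟-reflexive p
  ▷-reflexive (recv p _ _)     = ⨟-reflexive p
  ▷-reflexive (branch p _ _)   = ⨟-reflexive p
  ▷-reflexive (select _ p _ _) = ⨟-reflexive p
  ▷-reflexive (par _ p _ _)    = ⨟-reflexive p
  ▷-reflexive {Δ = Δ} (nil _ c) k with at Δ k | c k
  ... | just T  | done = just (≈-trans T end∙ T (done T refl) (≈-sym T end∙ (done T refl)))
  ... | nothing | _    = nothing
  ▷-reflexive (call _ p _ _ _) = ≋-trans p (≋-sym p)
  ▷-reflexive (callᵇ _ p _ _)  = ≋-trans p (≋-sym p)
  ▷-reflexive (brec _ ⊢Q _)    = ▷-reflexive ⊢Q
  ▷-reflexive (rec ⊢P _)       = ▷-reflexive ⊢P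
  ▷-reflexive (cond ⊢P _)      = ▷-reflexive ⊢P

  data _≈ᵉ_ : Entry → Entry → Set₂ where
    general : ∀ {A I Δ Δ′} → Δ ≈ᴱ Δ′ → general A I Δ ≈ᵉ general A I Δ′
    bounded : ∀ {L Δ Δ′} → Δ ≈ᴱ Δ′ → bounded L Δ ≈ᵉ bounded L Δ′

  -- A record rather than a bare function type, so that the contexts can be inferred from a proof;
  -- `Renames`, `Replaces`, `Erases` and `Ranked` are wrapped likewise.
  record _≈ᶜ_ (Γ Γ′ : Ctx n) : Set₂ where
    constructor pointwise
    field entry : ∀ X → lookup Γ X ≈ᵉ lookup Γ′ X
  open _≈ᶜ_

  general⁻ : ∀ {E E′ A I Δ} → E ≈ᵉ E′ → E ≡ general A I Δ →
             ∃[ Δ′ ] E′ ≡ general A I Δ′ × Δ ≈ᴱ Δ′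
  general⁻ (general p) refl = _ , refl , p

  bounded⁻ : ∀ {E E′ L Δ} → E ≈ᵉ E′ → E ≡ bounded L Δ →
             ∃[ Δ′ ] E′ ≡ bounded L Δ′ × Δ ≈ᴱ Δ′
  bounded⁻ (bounded p) refl = _ , refl , p

  addE-resp : ∀ {E E′} l → E ≈ᵉ E′ → addE l E ≈ᵉ addE l E′
  addE-resp l (general p) = general p
  addE-resp l (bounded p) = bounded p

  ⊞-resp : ∀ {Γ Γ′ : Ctx n} l → Γ ≈ᶜ Γ′ → (Γ ⊞ l) ≈ᶜ (Γ′ ⊞ l)
  ⊞-resp {Γ = Γ} {Γ′} l r .entry X
    rewrite lookup-map X (addE l) Γ | lookup-map X (addE l) Γ′ = addE-resp l (r .entry X)

  ∷-resp : ∀ {Γ Γ′ : Ctx n} {E E′} → E ≈ᵉ E′ → Γ ≈ᶜ Γ′ → (E ∷ Γ) ≈ᶜ (E′ ∷ Γ′)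
  ∷-resp e r .entry zero    = e
  ∷-resp e r .entry (suc X) = r .entry X

  Completed-resp : ∀ Δ Δ′ → Δ ≈ᴱ Δ′ → Completed Δ → Completed Δ′
  Completed-resp Δ Δ′ p c k T eq with at Δ k | c k | p k
  ... | just U  | d | q rewrite eq = ≈-trans T U end∙ (≈-sym U T (Pointwise.drop-just q)) (d U refl)
  Completed-resp Δ Δ′ p c k T eq | nothing | _ | q rewrite eq with () ← q

  HasDom-resp : ∀ Δ Δ′ {ks} → Δ ≈ᴱ Δ′ → HasDom Δ ks → HasDom Δ′ ks
  HasDom-resp _ _ p h k = mk⇔ (λ d → Equivalence.to (h k) (≋-support (≋-sym p) {k} d))
                          (λ i → ≋-support p {k} (Equivalence.from (h k) i))

  -- A recursive call is typed in an environment that is only equal to the declared one, and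
  -- unfolding needs the recursion retyped there. Premises of prefixes keep their environment, so
  -- reflexivity serves for them.
  ▷-resp : ∀ {Γ Γ′ : Ctx n} {L Δ Δ′} {P : Proc n m} → Γ ≈ᶜ Γ′ → Δ ≈ᴱ Δ′ →
           Γ ⨾ L ⊢ P ▷ Δ → Γ′ ⨾ L ⊢ P ▷ Δ′
  ▷-resp r q (send {Δ₀ = Δ₀} {Δ₁} {T = T} p p₁ ⊢P) =
    send {Δ₀ = Δ₀} {Δ₁} {T = T} (⨟-resp q p) p₁ (▷-resp r (▷-reflexive ⊢P) ⊢P)
  ▷-resp r q (recv {Δ₀ = Δ₀} {Δ₁} {T = T} p p₁ ⊢P) =
    recv {Δ₀ = Δ₀} {Δ₁} {T = T} (⨟-resp q p) p₁ (▷-resp r (▷-reflexive ⊢P) ⊢P)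
  ▷-resp r q (branch {Δ₀ = Δ₀} {Δ₁} {Ts = Ts} {d = d} {Δs} p ps ⊢Ps) =
    branch {Δ₀ = Δ₀} {Δ₁} {Ts = Ts} {d = d} {Δs} (⨟-resp q p) ps λ i →
      ▷-resp (⊞-resp _ r) (▷-reflexive (⊢Ps i)) (⊢Ps i)
  ▷-resp r q (select {Δ₀ = Δ₀} {Δ₁} {bs = bs} j p p₁ ⊢P) =
    select {Δ₀ = Δ₀} {Δ₁} {bs = bs} j (⨟-resp q p) p₁ (▷-resp (⊞-resp _ r) (▷-reflexive ⊢P) ⊢P)
  ▷-resp r q (par {Δ₁ = Δ₁} {Δ₂} eq p ⊢P ⊢Q) =
    par {Δ₁ = Δ₁} {Δ₂} eq (⨟-resp q p) (▷-resp r (▷-reflexive ⊢P) ⊢P) (▷-resp r (▷-reflexive ⊢Q) ⊢Q)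
  ▷-resp {Δ = Δ} {Δ′} r q (nil e c) = nil e (Completed-resp Δ Δ′ q c)
  ▷-resp {Δ = Δ} {Δ′} r q (call {X = X} eq p L⊆I I⊆A h) =
    let _ , eq′ , s = general⁻ (r .entry X) eq in
    call eq′ (≋-trans (≋-sym q) (≋-trans p s)) L⊆I I⊆A (HasDom-resp Δ Δ′ q h)
  ▷-resp {Δ = Δ} {Δ′} r q (callᵇ {X = X} eq p L⊆L′ h) =
    let _ , eq′ , s = bounded⁻ (r .entry X) eq in
    callᵇ eq′ (≋-trans (≋-sym q) (≋-trans p s)) L⊆L′ (HasDom-resp Δ Δ′ q h)
  ▷-resp r q (brec ⊢P ⊢Q L⊆L′) = brec (▷-resp (∷-resp (bounded q) r) q ⊢P) (▷-resp r q ⊢Q) L⊆L′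
  ▷-resp r q (rec ⊢P L⊆I)      = rec (▷-resp (∷-resp (general q) r) q ⊢P) L⊆I
  ▷-resp r q (cond ⊢P ⊢Q)      = cond (▷-resp r q ⊢P) (▷-resp r q ⊢Q)

  -- Substitution and unfolding

  ▷-dsub : ∀ {Γ : Ctx n} {L Δ} {P : Proc n m} (σ : Fin m → Expr m′) →
           Γ ⨾ L ⊢ P ▷ Δ → Γ ⨾ L ⊢ dsub σ P ▷ Δ
  ▷-dsub σ (send {Δ₀ = Δ₀} {T = T} p q ⊢P) =
    send {Δ₀ = Δ₀} {T = T} p q (▷-dsub σ ⊢P)
  ▷-dsub σ (recv {Δ₀ = Δ₀} {T = T} p q ⊢P) =
    recv {Δ₀ = Δ₀} {T = T} p q (▷-dsub (liftE σ) ⊢P)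
  ▷-dsub σ (branch {Δ₀ = Δ₀} {Ts = Ts} {d = d} p q ⊢Ps) =
    branch {Δ₀ = Δ₀} {Ts = Ts} {d = d} p q λ i → ▷-dsub σ (⊢Ps i)
  ▷-dsub σ (select {Δ₀ = Δ₀} {bs = bs} j p q ⊢P) =
    select {Δ₀ = Δ₀} {bs = bs} j p q (▷-dsub σ ⊢P)
  ▷-dsub σ (par e p ⊢P ⊢Q)    = par e p (▷-dsub σ ⊢P) (▷-dsub σ ⊢Q)
  ▷-dsub σ (nil e c)          = nil e c
  ▷-dsub σ (call x p q r h)   = call x p q r h
  ▷-dsub σ (callᵇ x p q h)    = callᵇ x p q h
  ▷-dsub σ (brec ⊢P ⊢Q q)     = brec (▷-dsub (liftE σ) ⊢P) (▷-dsub σ ⊢Q) q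
  ▷-dsub σ (rec ⊢P q)         = rec (▷-dsub σ ⊢P) q
  ▷-dsub σ (cond ⊢P ⊢Q)       = cond (▷-dsub σ ⊢P) (▷-dsub σ ⊢Q)

  record Renames (ρ : Fin n → Fin n′) (Γ : Ctx n) (Γ′ : Ctx n′) : Set₁ where
    constructor renames
    field entry : ∀ X → lookup Γ′ (ρ X) ≡ lookup Γ X
  open Renames

  Renames-⊞ : ∀ {ρ : Fin n → Fin n′} {Γ Γ′} l → Renames ρ Γ Γ′ → Renames ρ (Γ ⊞ l) (Γ′ ⊞ l)
  Renames-⊞ {ρ = ρ} {Γ} {Γ′} l r .entry X
    rewrite lookup-map X (addE l) Γ | lookup-map (ρ X) (addE l) Γ′ = cong (addE l) (r .entry X)

  Renames-lift : ∀ {ρ : Fin n → Fin n′} {Γ Γ′ E} → Renames ρ Γ Γ′ → Renames (lift 1 ρ) (E ∷ Γ) (E ∷ Γ′)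
  Renames-lift r .entry zero    = refl
  Renames-lift r .entry (suc X) = r .entry X

  ▷-pren : ∀ {Γ : Ctx n} {Γ′ : Ctx n′} {ρ L Δ} {P : Proc n m} → Renames ρ Γ Γ′ →
           Γ ⨾ L ⊢ P ▷ Δ → Γ′ ⨾ L ⊢ pren ρ P ▷ Δ
  ▷-pren r (send {Δ₀ = Δ₀} {T = T} p q ⊢P) =
    send {Δ₀ = Δ₀} {T = T} p q (▷-pren r ⊢P)
  ▷-pren r (recv {Δ₀ = Δ₀} {T = T} p q ⊢P) =
    recv {Δ₀ = Δ₀} {T = T} p q (▷-pren r ⊢P)
  ▷-pren r (branch {Δ₀ = Δ₀} {Ts = Ts} {d = d} p q ⊢Ps) =
    branch {Δ₀ = Δ₀} {Ts = Ts} {d = d} p q λ i → ▷-pren (Renames-⊞ _ r) (⊢Ps i)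
  ▷-pren r (select {Δ₀ = Δ₀} {bs = bs} j p q ⊢P) =
    select {Δ₀ = Δ₀} {bs = bs} j p q (▷-pren (Renames-⊞ _ r) ⊢P)
  ▷-pren r (par e p ⊢P ⊢Q)       = par e p (▷-pren r ⊢P) (▷-pren r ⊢Q)
  ▷-pren r (nil e c)             = nil e c
  ▷-pren r (call {X = X} x p q s h) = call (trans (r .entry X) x) p q s h
  ▷-pren r (callᵇ {X = X} x p q h)  = callᵇ (trans (r .entry X) x) p q h
  ▷-pren r (brec ⊢P ⊢Q q)        = brec (▷-pren (Renames-lift r) ⊢P) (▷-pren r ⊢Q) q
  ▷-pren r (rec ⊢P q)            = rec (▷-pren (Renames-lift r) ⊢P) q
  ▷-pren r (cond ⊢P ⊢Q)          = cond (▷-pren r ⊢P) (▷-pren r ⊢Q)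

  -- What the two call rules ask of L and Δ, except I ⊆ A.
  Admits : Entry → LabelSet → Env → Set₂
  Admits (general A I Δ′) L Δ = L ⊆ I × Δ ≈ᴱ Δ′
  Admits (bounded L′ Δ′)  L Δ = L ⊆ L′ × Δ ≈ᴱ Δ′

  Admits-addE : ∀ {L Δ} l E → Admits (addE l E) L Δ → Admits E L Δ
  Admits-addE l (general _ _ _) a = a
  Admits-addE l (bounded _ _)   a = a

  -- The second alternative asks for a typing in every context, which survives Γ ⊞ l;
  -- closed processes have one.
  record Replaces (θ : PSub n n′ m) (Γ : Ctx n) (Γ′ : Ctx n′) : Set₂ where
    constructor replaces
    field
      entry : ∀ X →
        (∃[ Y ] lookup Γ′ Y ≡ lookup Γ X × (∀ ks → θ X ks ≡ call Y ks)) ⊎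
        (∀ Γ″ ks {L Δ} → Admits (lookup Γ X) L Δ → Γ″ ⨾ L ⊢ θ X ks ▷ Δ)
  open Replaces

  Replaces-⊞ : ∀ {θ : PSub n n′ m} {Γ Γ′} l → Replaces θ Γ Γ′ → Replaces θ (Γ ⊞ l) (Γ′ ⊞ l)
  Replaces-⊞ {Γ = Γ} {Γ′} l r .entry X with r .entry X
  ... | inj₁ (Y , eq , e) = inj₁ (Y , trans (lookup-map Y (addE l) Γ′)
                                     (trans (cong (addE l) eq) (sym (lookup-map X (addE l) Γ))) , e)
  ... | inj₂ f = inj₂ λ Γ″ ks {L} {Δ} a → f Γ″ ks
          (Admits-addE l (lookup Γ X) (subst (λ E → Admits E L Δ) (lookup-map X (addE l) Γ) a))

  Replaces-weaken : ∀ {θ : PSub n n′ m} {Γ Γ′} → Replaces θ Γ Γ′ → Replaces (weakenPSub θ) Γ Γ′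
  Replaces-weaken r .entry X with r .entry X
  ... | inj₁ (Y , eq , e) = inj₁ (Y , eq , λ ks → cong (dsub _) (e ks))
  ... | inj₂ f            = inj₂ λ Γ″ ks a → ▷-dsub _ (f Γ″ ks a)

  Replaces-lift : ∀ {θ : PSub n n′ m} {Γ Γ′ E} → Replaces θ Γ Γ′ →
                  Replaces (liftPSub θ) (E ∷ Γ) (E ∷ Γ′)
  Replaces-lift r .entry zero = inj₁ (zero , refl , λ ks → refl)
  Replaces-lift r .entry (suc X) with r .entry X
  ... | inj₁ (Y , eq , e) = inj₁ (suc Y , eq , λ ks → cong (pren suc) (e ks))
  ... | inj₂ f            = inj₂ λ { (E ∷ Γ″) ks a → ▷-pren (renames λ Y → refl) (f Γ″ ks a) }

  ▷-psub : ∀ {Γ : Ctx n} {Γ′ : Ctx n′} {θ L Δ} {P : Proc n m} → Replaces θ Γ Γ′ →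
           Γ ⨾ L ⊢ P ▷ Δ → Γ′ ⨾ L ⊢ psub θ P ▷ Δ
  ▷-psub r (send {Δ₀ = Δ₀} {T = T} p q ⊢P) =
    send {Δ₀ = Δ₀} {T = T} p q (▷-psub r ⊢P)
  ▷-psub r (recv {Δ₀ = Δ₀} {T = T} p q ⊢P) =
    recv {Δ₀ = Δ₀} {T = T} p q (▷-psub (Replaces-weaken r) ⊢P)
  ▷-psub r (branch {Δ₀ = Δ₀} {Ts = Ts} {d = d} p q ⊢Ps) =
    branch {Δ₀ = Δ₀} {Ts = Ts} {d = d} p q λ i → ▷-psub (Replaces-⊞ _ r) (⊢Ps i)
  ▷-psub r (select {Δ₀ = Δ₀} {bs = bs} j p q ⊢P) =
    select {Δ₀ = Δ₀} {bs = bs} j p q (▷-psub (Replaces-⊞ _ r) ⊢P)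
  ▷-psub r (par e p ⊢P ⊢Q)    = par e p (▷-psub r ⊢P) (▷-psub r ⊢Q)
  ▷-psub r (nil e c)          = nil e c
  ▷-psub r (call {X = X} {ks} x p q s h) with r .entry X
  ... | inj₁ (Y , eq , e) rewrite e ks = call (trans eq x) p q s h
  ... | inj₂ f rewrite x = f _ ks (q , p)
  ▷-psub r (callᵇ {X = X} {ks} x p q h) with r .entry X
  ... | inj₁ (Y , eq , e) rewrite e ks = callᵇ (trans eq x) p q h
  ... | inj₂ f rewrite x = f _ ks (q , p)
  ▷-psub r (brec ⊢P ⊢Q q) = brec (▷-psub (Replaces-weaken (Replaces-lift r)) ⊢P) (▷-psub r ⊢Q) q
  ▷-psub r (rec ⊢P q)     = rec (▷-psub (Replaces-lift r) ⊢P) q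
  ▷-psub r (cond ⊢P ⊢Q)   = cond (▷-psub r ⊢P) (▷-psub r ⊢Q)

  -- The label set at a call lies below `I`, and `rec P` is typable with every such set, so it can
  -- stand in for each call.
  ▷-unfoldRec : ∀ {I Δ} {P : Proc 1 m} →
                (general ∅ I Δ ∷ []) ⨾ I ⊢ P ▷ Δ → [] ⨾ I ⊢ unfoldRec P ▷ Δ
  ▷-unfoldRec ⊢P = ▷-psub (replaces λ { zero → inj₂ λ { [] ks (L⊆I , p) →
    ▷-resp (pointwise λ ()) (≋-sym p) (rec ⊢P L⊆I) } }) ⊢P

  ▷-unfoldBrec : ∀ {L Δ b} {P : Proc 1 (suc m)} {Q} →
                 (bounded L Δ ∷ []) ⨾ L ⊢ P ▷ Δ → [] ⨾ L ⊢ Q ▷ Δ → [] ⨾ L ⊢ unfoldBrec b P Q ▷ Δ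
  ▷-unfoldBrec ⊢P ⊢Q = ▷-psub (replaces λ { zero → inj₂ λ { [] ks (L⊆L′ , p) →
    ▷-resp (pointwise λ ()) (≋-sym p) (brec ⊢P ⊢Q L⊆L′) } }) (▷-dsub _ ⊢P)

  -- Erasure to the standard typing

  env : Entry → Env
  env (general _ _ Δ) = Δ
  env (bounded _ Δ)   = Δ

  record Erases (Γ : Ctx n) (Θ : Vec Env n) : Set₁ where
    constructor erases
    field entry : ∀ X → env (lookup Γ X) ≡ lookup Θ X
  open Erases

  env-addE : ∀ l E → env (addE l E) ≡ env E
  env-addE l (general _ _ _) = refl
  env-addE l (bounded _ _)   = refl

  Erases-⊞ : ∀ {Γ : Ctx n} {Θ} l → Erases Γ Θ → Erases (Γ ⊞ l) Θ
  Erases-⊞ {Γ = Γ} l r .entry X rewrite lookup-map X (addE l) Γ = trans (env-addE l (lookup Γ X)) (r .entry X)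

  Erases-∷ : ∀ {Γ : Ctx n} {Θ E} → Erases Γ Θ → Erases (E ∷ Γ) (env E ∷ Θ)
  Erases-∷ r .entry zero    = refl
  Erases-∷ r .entry (suc X) = r .entry X

  erase : ∀ {Γ : Ctx n} {Θ L Δ} {P : Proc n m} → Erases Γ Θ → Γ ⨾ L ⊢ P ▷ Δ → Θ ⊢ₛ P ▷ Δ
  erase r (send {Δ₀ = Δ₀} {T = T} p q ⊢P) =
    send {Δ₀ = Δ₀} {T = T} p q (erase r ⊢P)
  erase r (recv {Δ₀ = Δ₀} {T = T} p q ⊢P) =
    recv {Δ₀ = Δ₀} {T = T} p q (erase r ⊢P)
  erase r (branch {Δ₀ = Δ₀} {Ts = Ts} {d = d} p q ⊢Ps) =
    branch {Δ₀ = Δ₀} {Ts = Ts} {d = d} p q λ i → erase (Erases-⊞ _ r) (⊢Ps i)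
  erase r (select {Δ₀ = Δ₀} {bs = bs} j p q ⊢P) =
    select {Δ₀ = Δ₀} {bs = bs} j p q (erase (Erases-⊞ _ r) ⊢P)
  erase r (par e p ⊢P ⊢Q)   = par p (erase r ⊢P) (erase r ⊢Q)
  erase r (nil e c)         = nil c
  erase r (call {Δ = Δ} {X = X} x p _ _ h) =
    call (subst (Δ ≈ᴱ_) (trans (sym (cong env x)) (r .entry X)) p) h
  erase r (callᵇ {Δ = Δ} {X = X} x p _ h)  =
    call (subst (Δ ≈ᴱ_) (trans (sym (cong env x)) (r .entry X)) p) h
  erase r (brec ⊢P ⊢Q _)    = brec (erase (Erases-∷ r) ⊢P) (erase r ⊢Q)
  erase r (rec ⊢P _)        = rec (erase (Erases-∷ r) ⊢P)
  erase r (cond ⊢P ⊢Q)      = cond (erase r ⊢P) (erase r ⊢Q)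

  -- Subject reduction

  -- L′ need not retain the pending part of L: that a request stays pending until it is
  -- answered is shown on processes, not on typings.
  record Reduct (Δ : Env) (a : Act) (P′ : Proc 0 m) : Set₂ where
    constructor reduct
    field
      {δ}      : ELabel
      {Δ′}     : Env
      {L′}     : LabelSet
      matching : δ ≃ a
      env-step : Δ —[ δ ]→ᴱ Δ′
      typing   : [] ⨾ L′ ⊢ P′ ▷ Δ′
      requests : request δ ⊆ L′
      dom-⊆    : dom Δ′ ⊆ dom Δ

  dual-involutive : ∀ k → dual (dual k) ≡ k
  dual-involutive (c , p) = cong (c ,_) (opposite-selfInverse refl)

  -- A process communication has its sender on `dual k` and its receiver on `k`. The environment
  -- rule dualises the channel of the sender, which puts the receiver on `dual (dual k)`.
  undual : ∀ {Δ Δ′ k ρ} → Δ —[ k ⦂ ρ ]→ᴱ Δ′ → Δ —[ dual (dual k) ⦂ ρ ]→ᴱ Δ′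
  undual {Δ} {Δ′} {k} {ρ} = subst (λ h → Δ —[ h ⦂ ρ ]→ᴱ Δ′) (sym (dual-involutive k))

  type-step : ∀ Δ₀ {Δ Δ₁ k} T {U ρ} → Δ ≅ Δ₀ ⨟ (k ∶ T) → Δ₁ ≅ Δ₀ ⨟ (k ∶ U) →
              (T ≈ T → T —⟨ ρ ⟩→ U) → Δ —[ k ⦂ ρ ]→ᴱ Δ₁
  type-step Δ₀ {k = k} T p q step =
    frame {Δ₂ = Δ₀} (type (step (at¹-reflexive k {T = T} (⨟-reflexiveʳ p)))) (⨟-comm p) (⨟-comm q)

  ▷-par : ∀ {L₁ L₂ Δ₁ Δ₂} {P Q : Proc 0 m} → (∀ k → ¬ (k ∈ dom Δ₁ × k ∈ dom Δ₂)) →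
          [] ⨾ L₁ ⊢ P ▷ Δ₁ → [] ⨾ L₂ ⊢ Q ▷ Δ₂ → [] ⨾ L₁ ∪ L₂ ⊢ P ∥ Q ▷ (Δ₁ ∪ᴱ Δ₂)
  ▷-par disjoint ⊢P ⊢Q =
    par (id , id) (disjoint , <∣>-reflexive (▷-reflexive ⊢P) (▷-reflexive ⊢Q)) ⊢P ⊢Q

  -- Induction on the transition, as recursions are retyped after unfolding. The request of a branch
  -- or selection is the right summand of the label set of its continuation; for parallel processes
  -- `dom-⊆` keeps the two reducts disjoint.
  subject-reduction : ∀ {L Δ a} {P P′ : Proc 0 m} →
                      [] ⨾ L ⊢ P ▷ Δ → P —[ a ]→ P′ → Reduct Δ a P′
  subject-reduction (send {Δ₀ = Δ₀} {T = T} p q ⊢P) (send _ _) =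
    reduct out (type-step Δ₀ (!∙ T) {T} p q out) ⊢P (λ ()) (⨟-support-at¹ _ p q)
  subject-reduction (recv {Δ₀ = Δ₀} {T = T} p q ⊢P) (recv _) =
    reduct inp (type-step Δ₀ (⁇∙ T) {T} p q inp) (▷-dsub _ ⊢P) (λ ()) (⨟-support-at¹ _ p q)
  subject-reduction (select {Δ₀ = Δ₀} {bs = bs} j p q ⊢P) (select _) =
    reduct sel (type-step Δ₀ (⊕∙ bs) {cont bs j} p q (sel bs j)) ⊢P inj₂ (⨟-support-at¹ _ p q)
  subject-reduction (branch {Δ₀ = Δ₀} {s = s} {ls} {Ls} {Ts} {d} p q ⊢Ps) (branch i _) =
    let bs = branches s ls d Ls Ts in
    reduct bra (type-step Δ₀ (&∙ bs) {Ts i} p (q i) (bra bs i)) (⊢Ps i) inj₂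
           (⨟-support-at¹ _ p (q i))
  subject-reduction (par {Δ₂ = Δ₂} _ p ⊢P ⊢Q) (parˡ t _) =
    let reduct {Δ′ = Δ₁′} c s ⊢P′ r d = subject-reduction ⊢P t
        p′ = ⨟-∪ᴱ p (▷-reflexive ⊢P′) (▷-reflexive ⊢Q) d id
    in reduct {Δ′ = Δ₁′ ∪ᴱ Δ₂} c (frame {Δ₂ = Δ₂} s p p′) (▷-par (proj₁ p′) ⊢P′ ⊢Q)
              (inj₁ ∘ r) (⨟-support p d id)
  subject-reduction (par {Δ₁ = Δ₁} _ p ⊢P ⊢Q) (parʳ t _) =
    let reduct {Δ′ = Δ₂′} c s ⊢Q′ r d = subject-reduction ⊢Q t
        p′ = ⨟-∪ᴱ p (▷-reflexive ⊢P) (▷-reflexive ⊢Q′) id d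
    in reduct {Δ′ = Δ₁ ∪ᴱ Δ₂′} c (frame {Δ₂ = Δ₁} s (⨟-comm p) (⨟-comm p′))
              (▷-par (proj₁ p′) ⊢P ⊢Q′) (inj₂ ∘ r) (⨟-support p id d)
  subject-reduction (par _ p ⊢P ⊢Q) (com!⁇ t u)
    with subject-reduction ⊢P t | subject-reduction ⊢Q u
  ... | reduct {Δ′ = Δ₁′} out s ⊢P′ _ d | reduct {Δ′ = Δ₂′} inp s′ ⊢Q′ _ d′ =
    let p′ = ⨟-∪ᴱ p (▷-reflexive ⊢P′) (▷-reflexive ⊢Q′) d d′
    in reduct {Δ′ = Δ₁′ ∪ᴱ Δ₂′} τ (com!⁇ s (undual s′) p p′)
              (▷-par (proj₁ p′) ⊢P′ ⊢Q′) (λ ()) (⨟-support p d d′)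
  subject-reduction (par _ p ⊢P ⊢Q) (com⁇! t u)
    with subject-reduction ⊢P t | subject-reduction ⊢Q u
  ... | reduct {Δ′ = Δ₁′} inp s ⊢P′ _ d | reduct {Δ′ = Δ₂′} out s′ ⊢Q′ _ d′ =
    let p′ = ⨟-∪ᴱ p (▷-reflexive ⊢P′) (▷-reflexive ⊢Q′) d d′
    in reduct {Δ′ = Δ₁′ ∪ᴱ Δ₂′} τ (com!⁇ s′ (undual s) (⨟-comm p) (⨟-comm p′))
              (▷-par (proj₁ p′) ⊢P′ ⊢Q′) (λ ()) (⨟-support p d d′)
  subject-reduction (par _ p ⊢P ⊢Q) (com⊕& t u)
    with subject-reduction ⊢P t | subject-reduction ⊢Q u
  ... | reduct {Δ′ = Δ₁′} sel s ⊢P′ r d | reduct {Δ′ = Δ₂′} bra s′ ⊢Q′ r′ d′ =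
    let p′ = ⨟-∪ᴱ p (▷-reflexive ⊢P′) (▷-reflexive ⊢Q′) d d′
    in reduct {Δ′ = Δ₁′ ∪ᴱ Δ₂′} τ∶ (com⊕& s (undual s′) p p′)
              (▷-par (proj₁ p′) ⊢P′ ⊢Q′) (λ { (inj₁ x) → inj₁ (r x) ; (inj₂ x) → inj₂ (r′ x) })
              (⨟-support p d d′)
  subject-reduction (par _ p ⊢P ⊢Q) (com&⊕ t u)
    with subject-reduction ⊢P t | subject-reduction ⊢Q u
  ... | reduct {Δ′ = Δ₁′} bra s ⊢P′ r d | reduct {Δ′ = Δ₂′} sel s′ ⊢Q′ r′ d′ =
    let p′ = ⨟-∪ᴱ p (▷-reflexive ⊢P′) (▷-reflexive ⊢Q′) d d′
    -- The environment rule lists the selecting side first, so the splittings and the requests are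
    -- swapped.
    in reduct {Δ′ = Δ₁′ ∪ᴱ Δ₂′} τ∶ (com⊕& s′ (undual s) (⨟-comm p) (⨟-comm p′))
              (▷-par (proj₁ p′) ⊢P′ ⊢Q′) (λ { (inj₁ x) → inj₂ (r′ x) ; (inj₂ x) → inj₁ (r x) })
              (⨟-support p d d′)
  subject-reduction (rec ⊢P _)       (rec t)      = subject-reduction (▷-unfoldRec ⊢P) t
  subject-reduction (brec ⊢P ⊢Q _)   (brec-0 _ t) = subject-reduction ⊢Q t
  subject-reduction (brec ⊢P ⊢Q _)   (brec-+ _ t) = subject-reduction (▷-unfoldBrec ⊢P ⊢Q) t
  subject-reduction (cond ⊢P ⊢Q)     (cond-t _ t) = subject-reduction ⊢P t
  subject-reduction (cond ⊢P ⊢Q)     (cond-f _ t) = subject-reduction ⊢Q t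

  -- Inevitability of a label

  -- Bounds of recursions may depend on received data, so ranks must branch infinitely.
  data Rank : Set₁ where
    node : {A : Set} → (A → Rank) → Rank

  data _≺_ : Rank → Rank → Set₁ where
    child : {A : Set} {r : A → Rank} (a : A) → r a ≺ node r

  ≺-wellFounded : WellFounded _≺_
  ≺-wellFounded (node r) = acc λ { (child a) → ≺-wellFounded (r a) }

  successor : Rank → Rank
  successor α = node {⊤} λ _ → α

  Ranks : ℕ → Set₁
  Ranks n = Fin n → Maybe Rank

  _▹_ : Maybe Rank → Ranks n → Ranks (suc n)
  (z ▹ Z) zero    = z
  (z ▹ Z) (suc X) = Z X

  -- f b is the rank of the loop with b iterations left.
  data Bound (e : Expr m) (f : ℕ → Rank) (α : Rank) : Set₁ where
    exactly : ∀ b → e ≡ val (nat b) → α ≡ f b → Bound e f α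
    unknown : (∀ b → f b ≺ α) → Bound e f α

  -- The process-side counterpart of `response`, so that answers can be sought in the process run
  -- alone.
  named : Act → LabelSet
  named (k ! v) = ∅
  named (k ⁇ v) = ∅
  named (k ⊕ l) = ｛ l ｝
  named (k & l) = ｛ l ｝
  named τ       = ∅
  named (τ∶_ l) = ｛ l ｝

  module _ (l : Label) where

    -- The label l comes up before any call of a variable without rank.  The rec rule
    -- leaves its variable unranked: by L ⊆ I ⊆ A, a pending l is answered in the body
    -- before the recursive call.
    data Inevitable (Z : Ranks n) (α : Rank) : Proc n m → Set₁ where
      send   : ∀ {β k e} {P : Proc n m} → β ≺ α → Inevitable Z β P → Inevitable Z α (send k e P)
      recv   : ∀ {β k} {P : Proc n (suc m)} → β ≺ α → Inevitable Z β P → Inevitable Z α (recv k P)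
      found  : ∀ {k} {P : Proc n m} → Inevitable Z α (select k l P)
      select : ∀ {β k l′} {P : Proc n m} → β ≺ α → Inevitable Z β P → Inevitable Z α (select k l′ P)
      branch : ∀ {k s ls} {Ps : Fin (suc s) → Proc n m} →
               (∀ i → ls i ≡ l ⊎ ∃[ β ] β ≺ α × Inevitable Z β (Ps i)) →
               Inevitable Z α (branch k s ls Ps)
      parˡ   : ∀ {β} {P Q : Proc n m} → β ≺ α → Inevitable Z β P → Inevitable Z α (P ∥ Q)
      parʳ   : ∀ {β} {P Q : Proc n m} → β ≺ α → Inevitable Z β Q → Inevitable Z α (P ∥ Q)
      rec    : ∀ {β} {P : Proc (suc n) m} → β ≺ α → Inevitable (nothing ▹ Z) β P →
               Inevitable Z α (rec P)
      brec   : ∀ {e β} {P : Proc (suc n) (suc m)} {Q} (f : ℕ → Rank) →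
               β ≺ f 0 → Inevitable Z β Q →
               (∀ b → ∃[ γ ] γ ≺ f (suc b) × Inevitable (just (f b) ▹ Z) γ P) →
               Bound e f α → Inevitable Z α (brec e P Q)
      call   : ∀ {X ks} → Z X ≡ just α → Inevitable Z α (call {m = m} X ks)
      cond   : ∀ {β γ e} {P Q : Proc n m} → β ≺ α → Inevitable Z β P → γ ≺ α → Inevitable Z γ Q →
               Inevitable Z α (cond e P Q)

    -- Ranks under renaming and substitution

    Offers : Ranks n → Rank → Label → Proc n m → Set₁
    Offers Z α l′ P = l′ ≡ l ⊎ ∃[ β ] β ≺ α × Inevitable Z β P

    -- A literal counter is fixed by substitution, while `unknown` dominates the ranks of all
    -- iteration counts and so survives whatever data arrives.
    Bound-sub : ∀ {e f α} (σ : Fin m → Expr m′) → Bound e f α → Bound (sub σ e) f α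
    Bound-sub σ (exactly b refl eq) = exactly b (sub-val σ (nat b)) eq
    Bound-sub σ (unknown p)         = unknown p

    Inevitable-dsub : ∀ {Z : Ranks n} {α} {P : Proc n m} (σ : Fin m → Expr m′) →
                      Inevitable Z α P → Inevitable Z α (dsub σ P)
    Offers-dsub : ∀ {Z : Ranks n} {α l′} {P : Proc n m} (σ : Fin m → Expr m′) →
                  Offers Z α l′ P → Offers Z α l′ (dsub σ P)

    Inevitable-dsub σ (send p x)   = send p (Inevitable-dsub σ x)
    Inevitable-dsub σ (recv p x)   = recv p (Inevitable-dsub (liftE σ) x)
    Inevitable-dsub σ found        = found
    Inevitable-dsub σ (select p x) = select p (Inevitable-dsub σ x)
    Inevitable-dsub σ (branch x)   = branch λ i → Offers-dsub σ (x i)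
    Inevitable-dsub σ (parˡ p x)   = parˡ p (Inevitable-dsub σ x)
    Inevitable-dsub σ (parʳ p x)   = parʳ p (Inevitable-dsub σ x)
    Inevitable-dsub σ (rec p x)    = rec p (Inevitable-dsub σ x)
    Inevitable-dsub σ (brec f p y x bd) =
      brec f p (Inevitable-dsub σ y)
        (λ b → let γ , q , z = x b in γ , q , Inevitable-dsub (liftE σ) z) (Bound-sub σ bd)
    Inevitable-dsub σ (call eq)      = call eq
    Inevitable-dsub σ (cond p x q y) = cond p (Inevitable-dsub σ x) q (Inevitable-dsub σ y)

    Offers-dsub σ (inj₁ eq)          = inj₁ eq
    Offers-dsub σ (inj₂ (β , p , x)) = inj₂ (β , p , Inevitable-dsub σ x)

    RenamesRanks : (Fin n → Fin n′) → Ranks n → Ranks n′ → Set₁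
    RenamesRanks ρ Z Z′ = ∀ X {β} → Z X ≡ just β → Z′ (ρ X) ≡ just β

    RenamesRanks-lift : ∀ {ρ : Fin n → Fin n′} {Z Z′ z} →
                        RenamesRanks ρ Z Z′ → RenamesRanks (lift 1 ρ) (z ▹ Z) (z ▹ Z′)
    RenamesRanks-lift r zero    eq = eq
    RenamesRanks-lift r (suc X) eq = r X eq

    Inevitable-pren : ∀ {ρ : Fin n → Fin n′} {Z Z′ α} {P : Proc n m} → RenamesRanks ρ Z Z′ →
                      Inevitable Z α P → Inevitable Z′ α (pren ρ P)
    Offers-pren : ∀ {ρ : Fin n → Fin n′} {Z Z′ α l′} {P : Proc n m} → RenamesRanks ρ Z Z′ →
                  Offers Z α l′ P → Offers Z′ α l′ (pren ρ P)

    Inevitable-pren r (send p x)   = send p (Inevitable-pren r x)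
    Inevitable-pren r (recv p x)   = recv p (Inevitable-pren r x)
    Inevitable-pren r found        = found
    Inevitable-pren r (select p x) = select p (Inevitable-pren r x)
    Inevitable-pren r (branch x)   = branch λ i → Offers-pren r (x i)
    Inevitable-pren r (parˡ p x)   = parˡ p (Inevitable-pren r x)
    Inevitable-pren r (parʳ p x)   = parʳ p (Inevitable-pren r x)
    Inevitable-pren r (rec p x)    = rec p (Inevitable-pren (RenamesRanks-lift r) x)
    Inevitable-pren r (brec f p y x bd) =
      brec f p (Inevitable-pren r y)
        (λ b → let γ , q , z = x b in γ , q , Inevitable-pren (RenamesRanks-lift r) z) bd
    Inevitable-pren r (call {X = X} eq) = call (r X eq)
    Inevitable-pren r (cond p x q y)    = cond p (Inevitable-pren r x) q (Inevitable-pren r y)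

    Offers-pren r (inj₁ eq)          = inj₁ eq
    Offers-pren r (inj₂ (β , p , x)) = inj₂ (β , p , Inevitable-pren r x)

    -- Only ranked variables constrain `θ`: an inevitable label never waits behind a call of an
    -- unranked one.
    ReplacesRanks : PSub n n′ m → Ranks n → Ranks n′ → Set₁
    ReplacesRanks θ Z Z′ = ∀ X {β} → Z X ≡ just β → ∀ ks → Inevitable Z′ β (θ X ks)

    ReplacesRanks-weaken : ∀ {θ : PSub n n′ m} {Z Z′} →
                           ReplacesRanks θ Z Z′ → ReplacesRanks (weakenPSub θ) Z Z′
    ReplacesRanks-weaken r X eq ks = Inevitable-dsub _ (r X eq ks)

    ReplacesRanks-lift : ∀ {θ : PSub n n′ m} {Z Z′ z} →
                         ReplacesRanks θ Z Z′ → ReplacesRanks (liftPSub θ) (z ▹ Z) (z ▹ Z′)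
    ReplacesRanks-lift r zero    eq ks = call eq
    ReplacesRanks-lift r (suc X) eq ks = Inevitable-pren (λ _ e → e) (r X eq ks)

    Inevitable-psub : ∀ {θ : PSub n n′ m} {Z Z′ α} {P : Proc n m} → ReplacesRanks θ Z Z′ →
                      Inevitable Z α P → Inevitable Z′ α (psub θ P)
    Offers-psub : ∀ {θ : PSub n n′ m} {Z Z′ α l′} {P : Proc n m} → ReplacesRanks θ Z Z′ →
                  Offers Z α l′ P → Offers Z′ α l′ (psub θ P)

    Inevitable-psub r (send p x)   = send p (Inevitable-psub r x)
    Inevitable-psub r (recv p x)   = recv p (Inevitable-psub (ReplacesRanks-weaken r) x)
    Inevitable-psub r found        = found
    Inevitable-psub r (select p x) = select p (Inevitable-psub r x)
    Inevitable-psub r (branch x)   = branch λ i → Offers-psub r (x i)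
    Inevitable-psub r (parˡ p x)   = parˡ p (Inevitable-psub r x)
    Inevitable-psub r (parʳ p x)   = parʳ p (Inevitable-psub r x)
    Inevitable-psub r (rec p x)    = rec p (Inevitable-psub (ReplacesRanks-lift r) x)
    Inevitable-psub r (brec f p y x bd) =
      brec f p (Inevitable-psub r y)
        (λ b → let γ , q , z = x b in
          γ , q , Inevitable-psub (ReplacesRanks-weaken (ReplacesRanks-lift r)) z) bd
    Inevitable-psub r (call {X = X} {ks} eq) = r X eq ks
    Inevitable-psub r (cond p x q y)         = cond p (Inevitable-psub r x) q (Inevitable-psub r y)

    Offers-psub r (inj₁ eq)          = inj₁ eq
    Offers-psub r (inj₂ (β , p , x)) = inj₂ (β , p , Inevitable-psub r x)

    -- The recursion variable is unranked, so the condition on its replacement is vacuous: on the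
    -- path followed, `l` comes up in this copy of the body.
    Inevitable-unfoldRec : ∀ {Z : Ranks 0} {α} {P : Proc 1 m} →
                           Inevitable (nothing ▹ Z) α P → Inevitable Z α (unfoldRec P)
    Inevitable-unfoldRec = Inevitable-psub λ { zero () }

    Inevitable-unfoldBrec : ∀ {Z : Ranks 0} {α β b} {P : Proc 1 (suc m)} {Q} →
                            Inevitable Z β (brec (val (nat b)) P Q) →
                            Inevitable (just β ▹ Z) α P → Inevitable Z α (unfoldBrec b P Q)
    Inevitable-unfoldBrec x y = Inevitable-psub (λ { zero refl ks → x }) (Inevitable-dsub _ y)

    -- From typings to ranks

    RankedEntry : Entry → Maybe Rank → Set₁
    RankedEntry (general A I Δ) z = l ∈ A → ∃[ β ] z ≡ just β
    RankedEntry (bounded L Δ)   z = l ∈ L → ∃[ β ] z ≡ just β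

    -- The invariant of the descent through a derivation. A general variable may stay unranked until
    -- `l` enters its set `A` of labels passed since the recursion began; a bounded one needs a rank
    -- if `l` may be pending at its calls.
    record Ranked (Γ : Ctx n) (Z : Ranks n) : Set₁ where
      constructor ranked
      field entry : ∀ X → RankedEntry (lookup Γ X) (Z X)
    open Ranked

    -- The descent stops at `l`, so every label that it passes differs from `l` and does not put `l`
    -- into `A`.
    Ranked-⊞ : ∀ {Γ : Ctx n} {Z l′} → l′ ≢ l → Ranked Γ Z → Ranked (Γ ⊞ l′) Z
    Ranked-⊞ {Γ = Γ} {Z} {l′} l′≢l r .entry X rewrite lookup-map X (addE l′) Γ
      with lookup Γ X | r .entry X
    ... | general _ _ _ | e = λ { (inj₁ l∈A) → e l∈A ; (inj₂ l′≡l) → ⊥-elim (l′≢l l′≡l) }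
    ... | bounded _ _   | e = e

    Ranked-∷ : ∀ {Γ : Ctx n} {Z E z} → RankedEntry E z → Ranked Γ Z → Ranked (E ∷ Γ) (z ▹ Z)
    Ranked-∷ e r .entry zero    = e
    Ranked-∷ e r .entry (suc X) = r .entry X

    -- The given ranks become the children of one node, which bounds them all without comparing
    -- them.
    supremum : ∀ {s} {A : Fin s → Set} {B : Fin s → Rank → Set₁} →
               (∀ i → A i ⊎ ∃ (B i)) → ∃[ α ] ∀ i → A i ⊎ ∃[ β ] β ≺ α × B i β
    supremum {s} {A} {B} h = node (λ i → rank (h i)) , λ i → below (h i) (child i)
      where
      rank : ∀ {i} → A i ⊎ ∃ (B i) → Rank
      -- A default for branches that answer `l` themselves; any rank would do.
      rank (inj₁ _)       = node {⊤} λ _ → node {⊥} λ ()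
      rank (inj₂ (β , _)) = β
      below : ∀ {i α} (x : A i ⊎ ∃ (B i)) → rank x ≺ α → A i ⊎ ∃[ β ] β ≺ α × B i β
      below (inj₁ a)       _ = inj₁ a
      below (inj₂ (β , b)) p = inj₂ (β , p , b)

    -- Induction on the derivation. A prefix naming another label keeps `l` pending, and `nil` is
    -- excluded by its empty label set. At a general call L ⊆ I ⊆ A puts `l` into `A`, so the
    -- invariant provides a rank.
    inevitable : ∀ {Γ : Ctx n} {Z L Δ} {P : Proc n m} → Ranked Γ Z →
                 Γ ⨾ L ⊢ P ▷ Δ → l ∈ L → ∃[ α ] Inevitable Z α P
    inevitable r (send _ _ ⊢P) l∈L = let α , x = inevitable r ⊢P l∈L in successor α , send (child tt) x
    inevitable r (recv _ _ ⊢P) l∈L = let α , x = inevitable r ⊢P l∈L in successor α , recv (child tt) x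
    inevitable {Z = Z} r (branch {ls = ls} {Ps = Ps} _ _ ⊢Ps) l∈L =
      let α , x = supremum next in α , branch x
      where
      next : ∀ i → ls i ≡ l ⊎ ∃[ α ] Inevitable Z α (Ps i)
      next i with ls i ≟ˡ l
      ... | yes eq = inj₁ eq
      ... | no  ne = inj₂ (inevitable (Ranked-⊞ ne r) (⊢Ps i) (inj₁ (l∈L , ne)))
    inevitable r (select {bs = bs} j _ _ ⊢P) l∈L with Branches.label bs j ≟ˡ l
    ... | yes refl = node {⊥} (λ ()) , found
    ... | no  ne   = let α , x = inevitable (Ranked-⊞ ne r) ⊢P (inj₁ (l∈L , ne)) in
                     successor α , select (child tt) x
    inevitable r (par (L⊆ , _) _ ⊢P ⊢Q) l∈L with L⊆ l∈L
    ... | inj₁ l∈L₁ = let α , x = inevitable r ⊢P l∈L₁ in successor α , parˡ (child tt) x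
    ... | inj₂ l∈L₂ = let α , x = inevitable r ⊢Q l∈L₂ in successor α , parʳ (child tt) x
    inevitable r (nil empty _) l∈L = ⊥-elim (empty l l∈L)
    inevitable r (call {X = X} eq _ L⊆I I⊆A _) l∈L
      with α , eq′ ← subst (λ E → RankedEntry E _) eq (r .entry X) (I⊆A (L⊆I l∈L)) = α , call eq′
    inevitable r (callᵇ {X = X} eq _ L⊆L′ _) l∈L
      with α , eq′ ← subst (λ E → RankedEntry E _) eq (r .entry X) (L⊆L′ l∈L) = α , call eq′
    inevitable {Z = Z} r (brec {P = P} ⊢P ⊢Q L⊆L′) l∈L =
      let α , y = inevitable r ⊢Q (L⊆L′ l∈L) in
      -- The bound is not evaluated here, so the rank lies above those of all iteration counts.
      node (loop α) ,
      brec (loop α) (child tt) y (λ b → _ , child tt , proj₂ (body (loop α b))) (unknown child)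
      where
      body : ∀ γ → ∃[ β ] Inevitable (just γ ▹ Z) β P
      body γ = inevitable (Ranked-∷ (λ _ → γ , refl) r) ⊢P (L⊆L′ l∈L)
      -- Iterates `body` from the rank of the exit process; the successors make every unfolding a
      -- strict descent.
      loop : Rank → ℕ → Rank
      loop α zero    = successor α
      loop α (suc b) = successor (proj₁ (body (loop α b)))
    inevitable r (rec ⊢P L⊆I) l∈L =
      -- The set `A` of a fresh recursion is empty, so its variable needs no rank.
      let α , x = inevitable (Ranked-∷ (λ ()) r) ⊢P (L⊆I l∈L) in successor α , rec (child tt) x
    inevitable r (cond ⊢P ⊢Q) l∈L =
      let α , x = inevitable r ⊢P l∈L ; β , y = inevitable r ⊢Q l∈L in
      node (λ b → if b then α else β) , cond (child true) x (child false) y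

  -- Components along a run

  -- Extends `TopLevel` from prefixes to arbitrary processes. Unfolding does not lengthen the
  -- address, so `rec P` and its unfolding are components at the same one.
  data Component : Proc n m → Address → Proc n m → Set where
    here   : ∀ {P : Proc n m} → Component P [] P
    parˡ   : ∀ {P Q R : Proc n m} {w} → Component P w R → Component (P ∥ Q) (left ∷ w) R
    parʳ   : ∀ {P Q R : Proc n m} {w} → Component Q w R → Component (P ∥ Q) (right ∷ w) R
    rec    : ∀ {P : Proc (suc n) m} {w R} → Component (unfoldRec P) w R → Component (rec P) w R
    brec-0 : ∀ {e} {P : Proc (suc n) (suc m)} {Q w R} →
             eval e ≡ nat 0 → Component Q w R → Component (brec e P Q) w R
    brec-+ : ∀ {e b} {P : Proc (suc n) (suc m)} {Q w R} →
             eval e ≡ nat (suc b) → Component (unfoldBrec b P Q) w R → Component (brec e P Q) w R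
    cond-t : ∀ {e} {P Q : Proc n m} {w R} →
             eval e ≡ bool true → Component P w R → Component (cond e P Q) w R
    cond-f : ∀ {e} {P Q : Proc n m} {w R} →
             eval e ≡ bool false → Component Q w R → Component (cond e P Q) w R

  expose : ∀ {P R R′ : Proc n m} {w} → Component P w R → R ⊳ R′ → ∃[ w′ ] Component P w′ R′
  expose here (parˡ)      = _ , parˡ here
  expose here (parʳ)      = _ , parʳ here
  expose here rec         = _ , rec here
  expose here (brec-0 eq) = _ , brec-0 eq here
  expose here (brec-+ eq) = _ , brec-+ eq here
  expose here (cond-t eq) = _ , cond-t eq here
  expose here (cond-f eq) = _ , cond-f eq here
  expose (parˡ c)      s = _ , parˡ (proj₂ (expose c s))
  expose (parʳ c)      s = _ , parʳ (proj₂ (expose c s))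
  expose (rec c)       s = _ , rec (proj₂ (expose c s))
  expose (brec-0 eq c) s = _ , brec-0 eq (proj₂ (expose c s))
  expose (brec-+ eq c) s = _ , brec-+ eq (proj₂ (expose c s))
  expose (cond-t eq c) s = _ , cond-t eq (proj₂ (expose c s))
  expose (cond-f eq c) s = _ , cond-f eq (proj₂ (expose c s))

  exposed : ∀ {P R : Proc n m} {w} → Component P w R → Star _⊳_ P R
  exposed here          = ε
  exposed (parˡ c)      = parˡ ◅ exposed c
  exposed (parʳ c)      = parʳ ◅ exposed c
  exposed (rec c)       = rec ◅ exposed c
  exposed (brec-0 eq c) = brec-0 eq ◅ exposed c
  exposed (brec-+ eq c) = brec-+ eq ◅ exposed c
  exposed (cond-t eq c) = cond-t eq ◅ exposed c
  exposed (cond-f eq c) = cond-f eq ◅ exposed c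

  topLevel : ∀ {P R : Proc n m} {w} → Component P w R → TopLevel R [] → TopLevel P w
  topLevel here          o = o
  topLevel (parˡ c)      o = parˡ (topLevel c o)
  topLevel (parʳ c)      o = parʳ (topLevel c o)
  topLevel (rec c)       o = rec (topLevel c o)
  topLevel (brec-0 eq c) o = brec-0 eq (topLevel c o)
  topLevel (brec-+ eq c) o = brec-+ eq (topLevel c o)
  topLevel (cond-t eq c) o = cond-t eq (topLevel c o)
  topLevel (cond-f eq c) o = cond-f eq (topLevel c o)

  record Moves (P′ : Proc n m) (a : Act) (w : Address) (R : Proc n m) : Set where
    constructor moves
    field
      {action}   : Act
      {residual} : Proc n m
      transition : R —[ action ]→ residual
      component  : Component P′ w residual
      named-⊆    : named action ⊆ named a

  -- In the second alternative `w` itself may go unexecuted: if `R` is a parallel composition, the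
  -- transition executes addresses below `w`.
  Advance : ∀ {P P′ : Proc n m} {a} → P —[ a ]→ P′ → Address → Proc n m → Set
  Advance {P′ = P′} {a} t w R = (w ∉ Executes t × Component P′ w R) ⊎ Moves P′ a w R

  nat-0≢suc : ∀ {m b} {e : Expr m} → eval e ≡ nat 0 → eval e ≡ nat (suc b) → ⊥
  nat-0≢suc p q with () ← nat-inj (trans (sym p) q)

  bool-t≢f : ∀ {m} {e : Expr m} → eval e ≡ bool true → eval e ≡ bool false → ⊥
  bool-t≢f p q with () ← bool-inj (trans (sym p) q)

  -- Component and transition descend together. They part only at a parallel composition, where the
  -- untouched side stays as it is; at conditionals and bounded recursions both follow the same
  -- evaluation.
  advance : ∀ {P P′ R : Proc n m} {a w} → Component P w R → (t : P —[ a ]→ P′) → Advance t w R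
  advance here t = inj₂ (moves t here id)
  advance (parˡ c) (parˡ t _) with advance c t
  ... | inj₁ (idle , c′)    = inj₁ (idle , parˡ c′)
  ... | inj₂ (moves u c′ s) = inj₂ (moves u (parˡ c′) s)
  advance (parˡ c) (parʳ t _) = inj₁ ((λ ()) , parˡ c)
  advance (parˡ c) (com!⁇ t _) with advance c t
  ... | inj₁ (idle , c′)    = inj₁ (idle , parˡ c′)
  ... | inj₂ (moves u c′ s) = inj₂ (moves u (parˡ c′) s)
  advance (parˡ c) (com⁇! t _) with advance c t
  ... | inj₁ (idle , c′)    = inj₁ (idle , parˡ c′)
  ... | inj₂ (moves u c′ s) = inj₂ (moves u (parˡ c′) s)
  advance (parˡ c) (com⊕& t _) with advance c t
  ... | inj₁ (idle , c′)    = inj₁ (idle , parˡ c′)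
  ... | inj₂ (moves u c′ s) = inj₂ (moves u (parˡ c′) s)
  advance (parˡ c) (com&⊕ t _) with advance c t
  ... | inj₁ (idle , c′)    = inj₁ (idle , parˡ c′)
  ... | inj₂ (moves u c′ s) = inj₂ (moves u (parˡ c′) s)
  advance (parʳ c) (parˡ t _) = inj₁ ((λ ()) , parʳ c)
  advance (parʳ c) (parʳ t _) with advance c t
  ... | inj₁ (idle , c′)    = inj₁ (idle , parʳ c′)
  ... | inj₂ (moves u c′ s) = inj₂ (moves u (parʳ c′) s)
  advance (parʳ c) (com!⁇ _ t) with advance c t
  ... | inj₁ (idle , c′)    = inj₁ (idle , parʳ c′)
  ... | inj₂ (moves u c′ s) = inj₂ (moves u (parʳ c′) s)
  advance (parʳ c) (com⁇! _ t) with advance c t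
  ... | inj₁ (idle , c′)    = inj₁ (idle , parʳ c′)
  ... | inj₂ (moves u c′ s) = inj₂ (moves u (parʳ c′) s)
  advance (parʳ c) (com⊕& _ t) with advance c t
  ... | inj₁ (idle , c′)    = inj₁ (idle , parʳ c′)
  ... | inj₂ (moves u c′ s) = inj₂ (moves u (parʳ c′) s)
  advance (parʳ c) (com&⊕ _ t) with advance c t
  ... | inj₁ (idle , c′)    = inj₁ (idle , parʳ c′)
  ... | inj₂ (moves u c′ s) = inj₂ (moves u (parʳ c′) s)
  advance (rec c) (rec t) = advance c t
  advance (brec-0 _ c) (brec-0 _ t) = advance c t
  advance (brec-0 {e = e} p _) (brec-+ q _) = ⊥-elim (nat-0≢suc {e = e} p q)
  advance (brec-+ {e = e} p _) (brec-0 q _) = ⊥-elim (nat-0≢suc {e = e} q p)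
  advance (brec-+ p c) (brec-+ q t) with refl ← nat-inj (trans (sym p) q) = advance c t
  advance (cond-t _ c) (cond-t _ t) = advance c t
  advance (cond-t {e = e} p _) (cond-f q _) = ⊥-elim (bool-t≢f {e = e} p q)
  advance (cond-f {e = e} p _) (cond-t q _) = ⊥-elim (bool-t≢f {e = e} q p)
  advance (cond-f _ c) (cond-f _ t) = advance c t

  -- Progress along a lock-free run

  earlier : ∀ {i j N} → i ≤ j → j <∞ N → i <∞ N
  earlier i≤j = All.map (≤-trans (s≤s i≤j))

  _<∞?_ : ∀ i N → Dec (i <∞ N)
  i <∞? N = All.dec (i <?_) N

  module LockFreeRuns {P : Proc 0 m} (sorted : WellSorted P) (r : ProcRun P) (lockFree : LockFreeRun r) where
    open Run r

    reachable : ∀ i → i ≤∞ len → Star _⟶_ P (state i)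
    reachable zero    _ = subst (Star _⟶_ P) (sym start) ε
    reachable (suc i) p =
      reachable i (All.map <⇒≤ p) ◅◅ (label i , step i p) ◅ ε

    evaluable : ∀ {i w R} → i ≤∞ len → Component (state i) w R → Evaluable R
    evaluable p c = sorted (reachable _ p) (exposed c)

    record Firing (i : ℕ) (w : Address) (R : Proc 0 m) : Set where
      constructor firing
      field
        {position} : ℕ
        later      : i ≤ position
        within     : position <∞ len
        move       : Moves (state (suc position)) (label position) w R

    -- Induction on the distance to a transition that executes `w`. Before it, `R` either moves or
    -- waits unchanged at `w`; at distance zero it cannot be idle.
    fire-after : ∀ d {i j w R} → d + i ≡ j → (p : j <∞ len) → Executes (step j p) w →
                 Component (state i) w R → Firing i w R
    fire-after zero refl p x c with advance c (step _ p)
    ... | inj₁ (idle , _) = ⊥-elim (idle x)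
    ... | inj₂ mv         = firing ≤-refl p mv
    fire-after (suc d) {i} refl p x c with q ← earlier (m≤n+m i (suc d)) p
      with advance c (step i q)
    ... | inj₂ mv       = firing ≤-refl q mv
    ... | inj₁ (_ , c′) with firing i<k q′ mv ← fire-after d (+-suc d i) p x c′ =
      firing (<⇒≤ i<k) q′ mv

    -- Lock-freedom enters here: it supplies a transition executing `w`, and `R` first moves then or
    -- earlier.
    fire : ∀ {i w R} → i ≤∞ len → Component (state i) w R → TopLevel R [] → Firing i w R
    fire {i} {w} p c o with j , i≤j , q , x ← lockFree i p w (topLevel c o) =
      fire-after (j ∸ i) (m∸n+n≡m i≤j) q x c

    Named : Label → ℕ → Set
    Named l i = ∃[ j ] i ≤ j × j <∞ len × l ∈ named (label j)

    Named-≤ : ∀ {l i j} → i ≤ j → Named l j → Named l i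
    Named-≤ i≤j (k , j≤k , rest) = k , ≤-trans i≤j j≤k , rest

    -- Induction on the rank. At a prefix, `fire` provides a step after which the residual has
    -- smaller rank; other processes are opened in place, within the same state. Calls do not arise,
    -- as `R` has no free process variable.
    eventually : ∀ {l α i w R} {Z : Ranks 0} → Acc _≺_ α → Inevitable l Z α R →
                 i ≤∞ len → Component (state i) w R → Named l i
    -- The rank follows the counter: with `b` iterations left it is `f b`, and unfolding descends to
    -- a body whose calls have the rank of the predecessor.
    unroll : ∀ {l e β i w P Q} {Z : Ranks 0} {f : ℕ → Rank} b → Acc _≺_ (f b) →
             β ≺ f 0 → Inevitable l Z β Q →
             (∀ b → ∃[ γ ] γ ≺ f (suc b) × Inevitable l (just (f b) ▹ Z) γ P) →
             eval e ≡ nat b → i ≤∞ len → Component (state i) w (brec e P Q) → Named l i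

    eventually (acc rs) (send p x) q c
      with firing i≤j q′ (moves (send _ _) c′ _) ← fire q c send =
      -- The residual appears in the state after the firing step, hence the extra successor.
      Named-≤ (≤-trans i≤j (n≤1+n _)) (eventually (rs p) x q′ c′)
    eventually (acc rs) (recv p x) q c
      with firing i≤j q′ (moves (recv _) c′ _) ← fire q c recv =
      Named-≤ (≤-trans i≤j (n≤1+n _)) (eventually (rs p) (Inevitable-dsub _ _ x) q′ c′)
    eventually _ found q c
      with firing i≤j q′ (moves (select _) c′ s) ← fire q c select = _ , i≤j , q′ , s refl
    eventually (acc rs) (select p x) q c
      with firing i≤j q′ (moves (select _) c′ _) ← fire q c select =
      Named-≤ (≤-trans i≤j (n≤1+n _)) (eventually (rs p) x q′ c′)
    eventually (acc rs) (branch x) q c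
      with firing i≤j q′ (moves (branch i _) c′ s) ← fire q c branch | x i
    ... | inj₁ eq          = _ , i≤j , q′ , s eq
    ... | inj₂ (_ , p , y) = Named-≤ (≤-trans i≤j (n≤1+n _)) (eventually (rs p) y q′ c′)
    eventually (acc rs) (parˡ p x) q c = eventually (rs p) x q (proj₂ (expose c parˡ))
    eventually (acc rs) (parʳ p x) q c = eventually (rs p) x q (proj₂ (expose c parʳ))
    eventually (acc rs) (rec p x) q c =
      eventually (rs p) (Inevitable-unfoldRec _ x) q (proj₂ (expose c rec))
    eventually a (brec f p y x bd) q c with evaluable q c | bd
    -- With a literal counter the rank is already `f b`, so accessibility is passed on unchanged.
    eventually a (brec f p y x bd) q c | b , eq | exactly b′ refl refl
      with refl ← nat-inj (trans (sym eq) (eval-val (nat b′))) = unroll b a p y x eq q c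
    eventually (acc rs) (brec f p y x bd) q c | b , eq | unknown below =
      unroll b (rs (below b)) p y x eq q c
    eventually (acc rs) (cond p x p′ y) q c with evaluable q c
    ... | true  , eq = eventually (rs p) x q (proj₂ (expose c (cond-t eq)))
    ... | false , eq = eventually (rs p′) y q (proj₂ (expose c (cond-f eq)))

    unroll zero (acc rs) p y _ eq q c = eventually (rs p) y q (proj₂ (expose c (brec-0 eq)))
    unroll (suc b) (acc rs) p y x eq q c =
      let _ , p′ , z = x b in
      eventually (rs p′) (Inevitable-unfoldBrec _ (brec _ p y x (exactly b refl refl)) z)
                 q (proj₂ (expose c (brec-+ eq)))

    named⇒response : ∀ {δ a} → δ ≃ a → named a ⊆ response δ
    named⇒response τ∶  l∈ = l∈
    named⇒response bra l∈ = l∈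
    named⇒response sel l∈ = l∈

    -- The environment run and its liveness

    module _ {L Δ} (⊢P : [] ⨾ L ⊢ P ▷ Δ) where

      -- States exist at every index, even past the end of a finite run; a derivation is owed only
      -- up to `len`.
      record Typing (i : ℕ) : Set₂ where
        field
          {L′}   : LabelSet
          {Δ′}   : Env
          typing : i ≤∞ len → [] ⨾ L′ ⊢ state i ▷ Δ′
      open Typing

      record Next {i} (s : Typing i) : Set₂ where
        field
          {δ}      : ELabel
          next     : Typing (suc i)
          matching : i <∞ len → δ ≃ label i
          env-step : i <∞ len → s .Δ′ —[ δ ]→ᴱ next .Δ′
          requests : i <∞ len → request δ ⊆ next .L′
      open Next

      advanceTyping : ∀ {i} (s : Typing i) → Next s
      advanceTyping {i} s with i <∞? len
      ... | yes p = record
        { next     = record { typing = λ _ → R.typing }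
        ; matching = λ _ → R.matching
        ; env-step = λ _ → R.env-step
        ; requests = λ _ → R.requests
        }
        where module R = Reduct (subject-reduction (s .typing (All.map <⇒≤ p)) (step i p))
      ... | no ¬p = record
        { δ        = τ
        ; next     = record { L′ = ∅ ; Δ′ = Δ ; typing = λ p → ⊥-elim (¬p p) }
        ; matching = λ p → ⊥-elim (¬p p)
        ; env-step = λ p → ⊥-elim (¬p p)
        ; requests = λ p → ⊥-elim (¬p p)
        }

      typings : ∀ i → Typing i
      typings zero    = record { typing = λ _ → subst (λ Q → [] ⨾ L ⊢ Q ▷ Δ) (sym start) ⊢P }
      typings (suc i) = advanceTyping (typings i) .next

      envRun : EnvRun Δ
      envRun = record
        { len   = len
        ; state = λ i → typings i .Δ′
        ; label = λ i → advanceTyping (typings i) .δ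
        ; start = refl
        ; step  = λ i → advanceTyping (typings i) .env-step
        }

      -- What step i requests is pending in the typing of state i + 1. The search starts there with
      -- the whole process as component, so the answer comes strictly after i.
      live : Live envRun
      live i p l∈ =
        let s = advanceTyping (typings i)
            _ , x = inevitable _ {Z = λ ()} (ranked λ ()) (s .next .typing p) (s .requests p l∈)
            j , i<j , q , l∈′ = eventually (≺-wellFounded _) x p here
        in j , i<j , q , named⇒response (advanceTyping (typings j) .matching q) l∈′

      typedRun : IsTypedRun [] r envRun
      typedRun = record
        { same-length = refl
        ; initial     = erase (erases λ ()) ⊢P
        ; typed-step  = λ i p → let s = advanceTyping (typings i) in record
          { source   = erase (erases λ ()) (typings i .typing (All.map <⇒≤ p))
          ; target   = erase (erases λ ()) (s .next .typing p)
          ; process  = step i p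
          ; env      = s .env-step p
          ; matching = s .matching p
          }
        }

theorem6p19 : (S : Signature) → let open Calculus S in
    ∀ {m : ℕ} (P : Proc 0 m) (L : LabelSet) (Δ : Env) →
    Conventional P → WellSorted P →
    [] ⨾ L ⊢ P ▷ Δ →
    LockFree P →
    LiveWrt P [] Δ
theorem6p19 S P L Δ _ sorted ⊢P lockFree r maximal = envRun ⊢P , live ⊢P , typedRun ⊢P
  where open LivenessTyping.LockFreeRuns S sorted r (lockFree r maximal)
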